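{- Let $H$ be a graph of order $k$ with at least one edge, and let $\widetilde{\sigma}(H)$ be the maximum of $\widetilde{\sigma}_i(H)$ over $i\in\{\alpha(H)+1,\ldots,k\}$. Then, as $n\to\infty$ (with $H$ fixed), $$\sigma(H,n)=\widetilde{\sigma}(H)\,n+o(n).$$
   Context: All graphs are finite and simple; the order of a graph is its number of vertices, $\alpha(H)$ is the independence number of $H$, and $\Delta(F)$ is the maximum degree of $F$. A sequence of nonnegative integers $\pi=(d_1,\dots,d_n)$ is graphic if it is the degree sequence of some simple graph of order $n$; such a graph is called a realization of $\pi$. $\sigma(\pi)$ denotes the sum of the terms of $\pi$. A graphic sequence $\pi$ is potentially $H$-graphic if at least one realization of $\pi$ contains $H$ as a (not necessarily induced) subgraph. $\sigma(H,n)$ denotes the minimum even integer such that every $n$-term graphic sequence $\pi$ with $\sigma(\pi)\ge\sigma(H,n)$ is potentially $H$-graphic. For $i\in\{\alpha(H)+1,\ldots,k\}$, where $k$ is the order of $H$, define $$\nabla_i(H)=\min\{\Delta(F): F \text{ is an induced subgraph of } H \text{ with } |V(F)|=i\},\qquad \widetilde{\sigma}_i(H)=2(k-i)+\nabla_i(H)-1.$$ -}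

module Defs where

open import Data.Bool using (Bool; false; T; T?)
open import Data.Fin using (Fin; zero; suc; finToFun; funToFin)
open import Data.Fin.Properties as Fin using (all?; any?; finToFun-funToFin)
open import Data.Fin.Subset using (Subset; inside; outside; ∣_∣; _∈_)
open import Data.Fin.Subset.Properties using (_∈?_; anySubset?; ∣p∣≤n)
open import Data.Integer as ℤ using (ℤ; +_)
open import Data.List as List using (List; []; _∷_; _++_; filter; upTo)
open import Data.List.Extrema.Nat using (max; min)
open import Data.Nat
  using (ℕ; zero; suc; _+_; _*_; _∸_; _≤_; _≥_; z≤n; s≤s; _≟_; _≤?_; _<?_)
open import Data.Nat.Divisibility using (_∣_; _∣?_; m∣m*n)
open import Data.Nat.Properties
  using (+-mono-≤; ≤-trans; m≤n*m; <⇒≱)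
open import Data.Product using (∃; ∃₂; _×_; _,_; proj₁; proj₂)
open import Data.Rational as ℚ using (ℚ; 0ℚ; _/_)
open import Data.Vec as Vec using (Vec; []; _∷_; sum; lookup; tabulate)
open import Data.Vec.Properties using (tabulate-cong; lookup∘tabulate; ≡-dec)
open import Function using (_∘_)
open import Function.Definitions using (Injective)
open import Relation.Binary.PropositionalEquality
  using (_≡_; _≗_; refl; sym; trans; cong; subst; subst₂)
open import Relation.Nullary using (Dec; yes; no; ¬_; ¬?; contradiction)
open import Relation.Nullary.Decidable
  using (map′; _×-dec_; _→-dec_; decidable-stable)
open import Relation.Unary using (Decidable)

record Graph (n : ℕ) : Set where
  field
    adj        : Fin n → Fin n → Bool
    adj-sym    : ∀ i j → adj i j ≡ adj j i
    adj-irrefl : ∀ i → adj i i ≡ false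

  Adj : Fin n → Fin n → Set
  Adj i j = T (adj i j)

  neighbours : Fin n → Subset n
  neighbours i = tabulate (adj i)

  degree : Fin n → ℕ
  degree i = ∣ neighbours i ∣

  degrees : Vec ℕ n
  degrees = tabulate degree

open Graph public

HasEdge : ∀ {n} → Graph n → Set
HasEdge G = ∃₂ λ i j → Adj G i j

-- Not necessarily induced.
_⊑_ : ∀ {k n} → Graph k → Graph n → Set
_⊑_ {k} {n} H G = ∃ λ (f : Fin k → Fin n) →
  Injective _≡_ _≡_ f × (∀ i j → Adj H i j → Adj G (f i) (f j))

subsets : ∀ n → List (Subset n)
subsets zero    = [] ∷ []
subsets (suc n) =
  List.map (inside ∷_) (subsets n) ++ List.map (outside ∷_) (subsets n)

Independent : ∀ {n} → Graph n → Subset n → Set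
Independent G S = ∀ i j → i ∈ S → j ∈ S → ¬ Adj G i j

independent? : ∀ {n} (G : Graph n) → Decidable (Independent G)
independent? G S = all? λ i → all? λ j →
  (i ∈? S) →-dec ((j ∈? S) →-dec ¬? (T? (adj G i j)))

α : ∀ {n} → Graph n → ℕ
α {n} G = max 0 (List.map ∣_∣ (filter (independent? G) (subsets n)))

Δ : ∀ {n} → Graph n → ℕ
Δ G = max 0 (List.tabulate (degree G))

elements : ∀ {n} (S : Subset n) → Fin ∣ S ∣ → Fin n
elements (inside  ∷ S) zero    = zero
elements (inside  ∷ S) (suc i) = suc (elements S i)
elements (outside ∷ S) i       = suc (elements S i)

induced : ∀ {n} → Graph n → (S : Subset n) → Graph ∣ S ∣
induced G S = record
  { adj        = λ i j → adj G (elements S i) (elements S j)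
  ; adj-sym    = λ i j → adj-sym G (elements S i) (elements S j)
  ; adj-irrefl = λ i → adj-irrefl G (elements S i)
  }

-- For i ≤ k the list is nonempty, and its entries are maximum degrees of
-- graphs of order i, hence at most k: the default k never affects the minimum.
∇ : ∀ {k} → ℕ → Graph k → ℕ
∇ {k} i H =
  min k (List.map (λ S → Δ (induced H S))
                  (filter (λ S → ∣ S ∣ ≟ i) (subsets k)))

-- Only used for α H < i ≤ k.  Then every induced subgraph of order i has an
-- edge, so ∇ i H ≥ 1 and neither subtraction truncates.
σ~ᵢ : ∀ {k} → ℕ → Graph k → ℕ
σ~ᵢ {k} i H = 2 * (k ∸ i) + ∇ i H ∸ 1

-- When H has an edge, α H < k and the range of indices is nonempty.
σ~ : ∀ {k} → Graph k → ℕ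
σ~ {k} H =
  max 0 (List.map (λ i → σ~ᵢ i H) (filter (λ i → α H <? i) (upTo (suc k))))

-- The i-th vertex has the i-th term as its degree; as the vertices may be
-- relabelled, the order of the terms is immaterial.
Realizes : ∀ {n} → Graph n → Vec ℕ n → Set
Realizes G π = degrees G ≡ π

Graphic : ∀ {n} → Vec ℕ n → Set
Graphic {n} π = ∃ λ (G : Graph n) → Realizes G π

PotentiallyGraphic : ∀ {k n} → Graph k → Vec ℕ n → Set
PotentiallyGraphic {n = n} H π = ∃ λ (G : Graph n) → Realizes G π × H ⊑ G

Forces : ∀ {k} → Graph k → (n s : ℕ) → Set
Forces H n s = (π : Vec ℕ n) → Graphic π → sum π ≥ s → PotentiallyGraphic H π

IsLeast : (ℕ → Set) → ℕ → Set
IsLeast P s = P s × (∀ t → P t → s ≤ t)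

-- If H has an edge, the zero sequence is graphic but not potentially
-- H-graphic, so every integer with the required property is positive and
-- minimising over ℕ is the same as minimising over ℤ.
IsPotentialNumber : ∀ {k} → Graph k → ℕ → ℕ → Set
IsPotentialNumber H n = IsLeast (λ s → 2 ∣ s × Forces H n s)

_≈_ : ∀ {n} → Graph n → Graph n → Set
G ≈ G′ = ∀ i j → adj G i j ≡ adj G′ i j

Respects≈ : ∀ {n} → (Graph n → Set) → Set
Respects≈ P = ∀ {G G′} → G ≈ G′ → P G → P G′

extend : ∀ {n} → Subset n → Graph n → Graph (suc n)
extend {n} S G = record { adj = a ; adj-sym = a-sym ; adj-irrefl = a-irrefl }
  where
  a : Fin (suc n) → Fin (suc n) → Bool
  a zero    zero    = false
  a zero    (suc j) = lookup S j
  a (suc i) zero    = lookup S i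
  a (suc i) (suc j) = adj G i j

  a-sym : ∀ i j → a i j ≡ a j i
  a-sym zero    zero    = refl
  a-sym zero    (suc j) = refl
  a-sym (suc i) zero    = refl
  a-sym (suc i) (suc j) = adj-sym G i j

  a-irrefl : ∀ i → a i i ≡ false
  a-irrefl zero    = refl
  a-irrefl (suc i) = adj-irrefl G i

emptyGraph : ∀ n → Graph n
emptyGraph n = record
  { adj = λ _ _ → false ; adj-sym = λ _ _ → refl ; adj-irrefl = λ _ → refl }

tailGraph : ∀ {n} → Graph (suc n) → Graph n
tailGraph G = record
  { adj        = λ i j → adj G (suc i) (suc j)
  ; adj-sym    = λ i j → adj-sym G (suc i) (suc j)
  ; adj-irrefl = λ i → adj-irrefl G (suc i)
  }

extend-cong : ∀ {n} (S : Subset n) {G G′ : Graph n} →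
              G ≈ G′ → extend S G ≈ extend S G′
extend-cong S e zero    zero    = refl
extend-cong S e zero    (suc j) = refl
extend-cong S e (suc i) zero    = refl
extend-cong S e (suc i) (suc j) = e i j

extend-tail : ∀ {n} (G : Graph (suc n)) →
              G ≈ extend (tabulate (adj G zero ∘ suc)) (tailGraph G)
extend-tail G zero    zero    = adj-irrefl G zero
extend-tail G zero    (suc j) = sym (lookup∘tabulate (adj G zero ∘ suc) j)
extend-tail G (suc i) zero    =
  trans (adj-sym G (suc i) zero) (sym (lookup∘tabulate (adj G zero ∘ suc) i))
extend-tail G (suc i) (suc j) = refl

anyGraph? : ∀ {n} {P : Graph n → Set} → Respects≈ P → Decidable P → Dec (∃ P)
anyGraph? {zero} resp P? =
  map′ (λ p → emptyGraph 0 , p) (λ (G , p) → resp {G} (λ ()) p)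
       (P? (emptyGraph 0))
anyGraph? {suc n} {P} resp P? =
  map′ (λ (S , G , p) → extend S G , p)
       (λ (G , p) → _ , tailGraph G , resp {G} (extend-tail G) p)
       (anySubset? λ S → anyGraph? {P = λ G → P (extend S G)}
          (λ {G} {G′} e → resp {extend S G} (extend-cong S {G} {G′} e))
          (λ G → P? (extend S G)))

degrees-cong : ∀ {n} {G G′ : Graph n} → G ≈ G′ → degrees G ≡ degrees G′
degrees-cong e = tabulate-cong λ i → cong ∣_∣ (tabulate-cong (e i))

⊑-resp-≈ : ∀ {k n} (H : Graph k) {G G′ : Graph n} → G ≈ G′ → H ⊑ G → H ⊑ G′
⊑-resp-≈ H e (f , inj , hom) =
  f , inj , λ i j h → subst T (e (f i) (f j)) (hom i j h)

⊑? : ∀ {k n} (H : Graph k) (G : Graph n) → Dec (H ⊑ G)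
⊑? {k} {n} H G =
  map′ (λ (c , p) → finToFun c , fromEmb (finToFun c) p)
       (λ (f , p) → funToFin f ,
                    emb-resp (λ i → sym (finToFun-funToFin f i)) (toEmb f p))
       (any? λ c → emb? (finToFun c))
  where
  Emb : (Fin k → Fin n) → Set
  Emb f = ∀ i j → (f i ≡ f j → i ≡ j) × (Adj H i j → Adj G (f i) (f j))

  emb? : Decidable Emb
  emb? f = all? λ i → all? λ j →
    ((f i Fin.≟ f j) →-dec (i Fin.≟ j)) ×-dec
    (T? (adj H i j) →-dec T? (adj G (f i) (f j)))

  emb-resp : ∀ {f g} → f ≗ g → Emb f → Emb g
  emb-resp e p i j =
    (λ q → proj₁ (p i j) (trans (e i) (trans q (sym (e j))))) ,
    (λ h → subst₂ (Adj G) (e i) (e j) (proj₂ (p i j) h))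

  fromEmb : ∀ f → Emb f →
            Injective _≡_ _≡_ f × (∀ i j → Adj H i j → Adj G (f i) (f j))
  fromEmb f p = (λ {i} {j} → proj₁ (p i j)) , λ i j → proj₂ (p i j)

  toEmb : ∀ f → Injective _≡_ _≡_ f × (∀ i j → Adj H i j → Adj G (f i) (f j)) →
          Emb f
  toEmb f (inj , hom) i j = inj , hom i j

potentiallyGraphic? : ∀ {k n} (H : Graph k) (π : Vec ℕ n) →
                      Dec (PotentiallyGraphic H π)
potentiallyGraphic? H π = anyGraph?
  (λ {G} {G′} e (r , c) →
     trans (sym (degrees-cong {G = G} {G′} e)) r , ⊑-resp-≈ H {G} {G′} e c)
  (λ G → ≡-dec _≟_ (degrees G) π ×-dec ⊑? H G)

forces? : ∀ {k} (H : Graph k) n → Decidable (Forces H n)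
forces? H n s = map′ to from (¬? (anyGraph? (λ {G} {G′} → resp {G} {G′}) bad?))
  where
  Bad : Vec ℕ n → Set
  Bad π = sum π ≥ s × ¬ PotentiallyGraphic H π

  resp : Respects≈ (Bad ∘ degrees)
  resp {G} {G′} e = subst Bad (degrees-cong {G = G} {G′} e)

  bad? : Decidable (Bad ∘ degrees)
  bad? G = (s ≤? sum (degrees G)) ×-dec ¬? (potentiallyGraphic? H (degrees G))

  to : ¬ ∃ (Bad ∘ degrees) → Forces H n s
  to ¬bad _ (G , refl) s≤ =
    decidable-stable (potentiallyGraphic? H (degrees G))
      (λ ¬p → ¬bad (G , s≤ , ¬p))

  from : Forces H n s → ¬ ∃ (Bad ∘ degrees)
  from forces (G , s≤ , ¬p) = ¬p (forces (degrees G) (G , refl) s≤)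

least : ∀ {P : ℕ → Set} → Decidable P → ∀ m → P m → ∃ (IsLeast P)
least P? zero    p = 0 , p , λ _ _ → z≤n
least {P} P? (suc m) p with P? 0
... | yes p₀ = 0 , p₀ , λ _ _ → z≤n
... | no ¬p₀ with s , pₛ , s≤ ← least (P? ∘ suc) m p =
  suc s , pₛ , λ { zero p₀ → contradiction p₀ ¬p₀ ; (suc t) pₜ → s≤s (s≤ t pₜ) }

sum-tabulate-≤ : ∀ {n b} (f : Fin n → ℕ) → (∀ i → f i ≤ b) →
                 sum (tabulate f) ≤ n * b
sum-tabulate-≤ {zero}  f f≤ = z≤n
sum-tabulate-≤ {suc n} f f≤ = +-mono-≤ (f≤ zero) (sum-tabulate-≤ (f ∘ suc) (f≤ ∘ suc))

potentialNumber : ∀ {k} (H : Graph k) n → ∃ (IsPotentialNumber H n)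
potentialNumber H n = least (λ s → (2 ∣? s) ×-dec forces? H n s)
  (2 * suc (n * n)) (m∣m*n (suc (n * n)) , vacuous)
  where
  vacuous : Forces H n (2 * suc (n * n))
  vacuous _ (G , refl) s≤ = contradiction
    (≤-trans (m≤n*m (suc (n * n)) 2) s≤)
    (<⇒≱ (s≤s (sum-tabulate-≤ (degree G) (λ i → ∣p∣≤n (neighbours G i)))))

σ : ∀ {k} → Graph k → ℕ → ℕ
σ H n = proj₁ (potentialNumber H n)

σ-isPotentialNumber : ∀ {k} (H : Graph k) n → IsPotentialNumber H n (σ H n)
σ-isPotentialNumber H n = proj₂ (potentialNumber H n)

IsLittleO[n] : (ℕ → ℤ) → Set
IsLittleO[n] f = ∀ (ε : ℚ) → 0ℚ ℚ.< ε →
  ∃ λ N → ∀ n → n ≥ N → + ℤ.∣ f n ∣ / 1 ℚ.≤ ε ℚ.* (+ n / 1)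

module Submission where

-- The deviation of σ H n from σ~ H * n is even bounded by a constant depending on H.
--
-- Upper bound.  Call a vertex large if its degree is at least a suitable constant.  If there are k
-- large vertices, edge switches turn them, or otherwise k of their neighbours, into a clique
-- (or a clique is already there), so assume fewer.  Let t v be the number of large neighbours
-- of v.  Counting the edges at large vertices from their small ends, Σ deg is, up to a constant,
-- the sum of deg v + t v over the small v.  If Σ deg exceeds σ~ H * n by a large constant, then many
-- small v have deg v + t v > σ~ H, and among these many have the same set T of large
-- neighbours and are pairwise far apart in the graph induced on the small vertices.  By the choice
-- of σ~ there is a set S of vertices of H such that at most ∣ T ∣ vertices lie outside S and the
-- maximum degree in S is at most deg v − t v: a maximum independent set if k ≤ ∣ T ∣ + α H, and
-- a minimiser for ∇ (k ∸ ∣ T ∣) otherwise.  Put S on the far apart vertices and the rest in T.  Edges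
-- between the two parts are present, those inside either part are obtained by switches.
--
-- Lower bound.  With r = k ∸ i and d = ∇ i H ∸ 1, consider r dominating vertices and disjoint
-- cliques of size suc d.  In every realization of the degrees the r vertices dominate and
-- the remaining graph has maximum degree at most d, whereas a copy of H would have i vertices there.

open import Defs
open import Data.Nat using (ℕ; _*_)

open import Algebra.Properties.CommutativeMonoid.Sum using ()
open import Data.Bool using (Bool; true; false; T; T?; _∧_; _∨_; not; _xor_; if_then_else_)
open import Data.Bool.Properties using (T-∧; T-∨; T-≡; ∧-comm; ∨-comm)
open import Data.Empty using (⊥; ⊥-elim)
open import Data.Fin
  using (Fin; zero; suc; toℕ; fromℕ<; combine; remQuot; _↑ˡ_; _↑ʳ_)
import Data.Fin.Permutation as Perm
open import Data.Fin.Properties as Fin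
  using (_≟_; suc-injective; toℕ-injective; toℕ-fromℕ<; toℕ<n; all?; any?; ¬∀⟶∃¬;
         combine-injective; remQuot-combine; ↑ˡ-injective; ↑ʳ-injective)
open import Data.Fin.Subset
  using (Subset; inside; outside; ∣_∣; _∈_) renaming (⊤ to ⊤ˢ; ⊥ to ⊥ˢ)
open import Data.Fin.Subset.Properties using (∣⊤∣≡n; ∣⊥∣≡0; ∉⊥)
import Data.Integer as ℤ
import Data.Integer.Properties as ℤ
open import Data.List as List
  using (List; []; _∷_; _++_; length; concatMap; filter; upTo; allFin; cartesianProduct)
open import Data.List.Extrema.Nat using (argmin-sel; argmax-sel; xs≤max; min≤xs; v≤min⁺)
open import Data.List.Membership.Propositional using () renaming (_∈_ to _∈ˡ_; _∉_ to _∉ˡ_)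
open import Data.List.Membership.Propositional.Properties
  using (∈-++⁺ˡ; ∈-++⁺ʳ; ∈-map⁺; ∈-map⁻; ∈-allFin; ∈-cartesianProduct⁺; ∈-tabulate⁺; ∈-tabulate⁻;
         ∈-filter⁺; ∈-filter⁻; ∈-upTo⁺; ∈-upTo⁻)
open import Data.List.Properties using (length-++; length-map; length-tabulate)
import Data.List.Relation.Unary.All as All
open import Data.List.Relation.Unary.Any using (here; there)
open import Data.Nat
  using (zero; suc; _+_; _^_; _∸_; _⊔_; _≤_; _<_; _≥_; z≤n; s≤s; s≤s⁻¹; _≤?_; _<?_)
open import Data.Nat.Divisibility using (n∣m*n)
open import Data.Nat.DivMod
  using (_/_; _%_; +-distrib-/-∣ˡ; m*n/n≡m; m/n*n≤m; m<n⇒m/n≡0; m≡m%n+[m/n]*n; m%n<n)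
open import Data.Nat.Properties as ℕ hiding (_≟_; suc-injective)
open import Data.Product using (∃; ∃₂; _×_; _,_; proj₁; proj₂)
open import Data.Rational as ℚ using (mkℚ; toℚᵘ)
import Data.Rational.Properties as ℚ
open import Data.Rational.Unnormalised using (mkℚᵘ; *≤*)
import Data.Rational.Unnormalised.Properties as ℚᵘ
open import Data.Sum as Sum using (_⊎_; inj₁; inj₂; [_,_]′)
open import Data.Unit using (tt)
open import Data.Vec as Vec using ([]; _∷_; lookup; tabulate)
open import Data.Vec.Properties
  using (tabulate-cong; lookup∘tabulate; tabulate∘lookup; []=⇒lookup; lookup⇒[]=)
open import Function using (_∘_; id)
open import Function.Bundles using (Equivalence; mk⇔)
open import Function.Definitions using (Injective)
open import Relation.Binary.Definitions using (Symmetric)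
open import Relation.Binary.PropositionalEquality
open import Relation.Nullary using (Dec; yes; no; does; ¬_; ¬?; contradiction)
open import Relation.Nullary.Decidable using (decidable-stable; does-⇔; _×-dec_)

open Algebra.Properties.CommutativeMonoid.Sum ℕ.+-0-commutativeMonoid
  using (∑-distrib-+; ∑-comm; sum-permute; sum-cong-≗) renaming (sum to ∑)

-- Counting with Boolean predicates.

𝟙 : Bool → ℕ
𝟙 true  = 1
𝟙 false = 0

# : ∀ {n} → (Fin n → Bool) → ℕ
# f = ∑ (𝟙 ∘ f)

∧⁺ : ∀ {a b} → T a → T b → T (a ∧ b)
∧⁺ p q = Equivalence.from T-∧ (p , q)

∧⁻ : ∀ {a b} → T (a ∧ b) → T a × T b
∧⁻ = Equivalence.to T-∧

T-not⁺ : ∀ {b} → ¬ T b → T (not b)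
T-not⁺ {true}  p = ⊥-elim (p tt)
T-not⁺ {false} p = tt

T-not⁻ : ∀ {b} → T (not b) → ¬ T b
T-not⁻ {false} _ ()

does⁺ : ∀ {P : Set} (P? : Dec P) → P → T (does P?)
does⁺ (yes _) p = tt
does⁺ (no ¬p) p = ¬p p

does⁻ : ∀ {P : Set} (P? : Dec P) → T (does P?) → P
does⁻ (yes p) _ = p

∑-mono : ∀ {n} {f g : Fin n → ℕ} → (∀ i → f i ≤ g i) → ∑ f ≤ ∑ g
∑-mono {zero}  p = z≤n
∑-mono {suc n} p = +-mono-≤ (p zero) (∑-mono (p ∘ suc))

∑-const : ∀ n c → ∑ {n} (λ _ → c) ≡ n * c
∑-const zero    c = refl
∑-const (suc n) c = cong (c +_) (∑-const n c)

∑-*ʳ : ∀ {n} (f : Fin n → ℕ) c → ∑ (λ i → f i * c) ≡ ∑ f * c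
∑-*ʳ {zero}  f c = refl
∑-*ʳ {suc n} f c =
  trans (cong (f zero * c +_) (∑-*ʳ (f ∘ suc) c))
        (sym (*-distribʳ-+ c (f zero) (∑ (f ∘ suc))))

T⇒1≤𝟙 : ∀ {b} → T b → 1 ≤ 𝟙 b
T⇒1≤𝟙 {true} _ = ≤-refl

¬T⇒𝟙≡0 : ∀ {b} → ¬ T b → 𝟙 b ≡ 0
¬T⇒𝟙≡0 {true}  p = ⊥-elim (p tt)
¬T⇒𝟙≡0 {false} p = refl

𝟙-mono : ∀ {a b} → (T a → T b) → 𝟙 a ≤ 𝟙 b
𝟙-mono {true}  p = T⇒1≤𝟙 (p tt)
𝟙-mono {false} p = z≤n

𝟙-split : ∀ a b → 𝟙 b ≡ 𝟙 (a ∧ b) + 𝟙 (not a ∧ b)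
𝟙-split true  b = sym (+-identityʳ (𝟙 b))
𝟙-split false b = refl

#-mono : ∀ {n} {f g : Fin n → Bool} → (∀ i → T (f i) → T (g i)) → # f ≤ # g
#-mono p = ∑-mono (λ i → 𝟙-mono (p i))

#-split : ∀ {n} (f g : Fin n → Bool) →
          # g ≡ # (λ i → f i ∧ g i) + # (λ i → not (f i) ∧ g i)
#-split f g = trans (sum-cong-≗ (λ i → 𝟙-split (f i) (g i)))
                    (∑-distrib-+ (λ i → 𝟙 (f i ∧ g i)) _)

#-const : ∀ n → # {n} (λ _ → true) ≡ n
#-const n = trans (∑-const n 1) (*-identityʳ n)

#-not : ∀ {n} (f : Fin n → Bool) → # (not ∘ f) + # f ≡ n
#-not {zero}  f = refl
#-not {suc n} f with f zero
... | true  = trans (+-suc (# (not ∘ f ∘ suc)) _) (cong suc (#-not (f ∘ suc)))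
... | false = cong suc (#-not (f ∘ suc))

#≤n : ∀ {n} (f : Fin n → Bool) → # f ≤ n
#≤n {n} f = subst (# f ≤_) (#-const n) (#-mono {f = f} {g = λ _ → true} _)

#-false : ∀ {n} {f : Fin n → Bool} → (∀ i → ¬ T (f i)) → # f ≡ 0
#-false {zero}  p = refl
#-false {suc n} p = cong₂ _+_ (¬T⇒𝟙≡0 (p zero)) (#-false (p ∘ suc))

#-singleton : ∀ {n} (i : Fin n) → # (λ j → does (j ≟ i)) ≡ 1
#-singleton {suc n} zero = cong suc (#-false {n} {λ j → does (suc j ≟ zero)} (λ _ ()))
#-singleton (suc i) = #-singleton i

_∖_ : ∀ {n} → (Fin n → Bool) → Fin n → (Fin n → Bool)
(f ∖ l) j = not (does (j ≟ l)) ∧ f j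

∖⁻ : ∀ {n} (f : Fin n → Bool) {l j} → T ((f ∖ l) j) → T (f j) × j ≢ l
∖⁻ f {l} {j} p with p₁ , p₂ ← ∧⁻ {not (does (j ≟ l))} p =
  p₂ , λ e → T-not⁻ p₁ (does⁺ (j ≟ l) e)

∖⁺ : ∀ {n} (f : Fin n → Bool) {l j} → T (f j) → j ≢ l → T ((f ∖ l) j)
∖⁺ f {l} {j} p j≢l = ∧⁺ (T-not⁺ {does (j ≟ l)} (j≢l ∘ does⁻ (j ≟ l))) p

#-remove-≤ : ∀ {n} (f : Fin n → Bool) l → # f ≤ suc (# (f ∖ l))
#-remove-≤ f l = begin
  # f                                          ≡⟨ #-split (λ j → does (j ≟ l)) f ⟩
  # (λ j → does (j ≟ l) ∧ f j) + # (f ∖ l)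
    ≤⟨ +-monoˡ-≤ _ (#-mono {g = λ j → does (j ≟ l)} (λ j → proj₁ ∘ ∧⁻)) ⟩
  # (λ j → does (j ≟ l)) + # (f ∖ l)              ≡⟨ cong (_+ # (f ∖ l)) (#-singleton l) ⟩
  suc (# (f ∖ l))                              ∎
  where open ≤-Reasoning

#-remove : ∀ {n} (f : Fin n → Bool) l → T (f l) → suc (# (f ∖ l)) ≤ # f
#-remove f l p = begin
  suc (# (f ∖ l))                              ≡⟨ cong (_+ # (f ∖ l)) (sym (#-singleton l)) ⟩
  # (λ j → does (j ≟ l)) + # (f ∖ l)
    ≤⟨ +-monoˡ-≤ _ (#-mono {f = λ j → does (j ≟ l)}
        (λ j e → ∧⁺ e (subst (T ∘ f) (sym (does⁻ (j ≟ l) e)) p))) ⟩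
  # (λ j → does (j ≟ l) ∧ f j) + # (f ∖ l)        ≡⟨ sym (#-split (λ j → does (j ≟ l)) f) ⟩
  # f                                          ∎
  where open ≤-Reasoning

#-nonempty : ∀ {n} (f : Fin n → Bool) → 0 < # f → ∃ (T ∘ f)
#-nonempty {suc n} f p with T? (f zero)
... | yes q = zero , q
... | no ¬q with j , q ← #-nonempty (f ∘ suc) (subst (λ b → 0 < b + # (f ∘ suc)) (¬T⇒𝟙≡0 ¬q) p) =
    suc j , q

-- Choice and injection under cardinality bounds.

pick : ∀ {n} (f : Fin n → Bool) (L : List (Fin n)) → length L < # f →
       ∃ λ j → T (f j) × j ∉ˡ L
pick f []      p with j , q ← #-nonempty f p = j , q , λ ()
pick f (l ∷ L) p with j , q , r ← pick (f ∖ l) L (s≤s⁻¹ (≤-trans p (#-remove-≤ f l)))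
  with q₁ , q₂ ← ∖⁻ f q = j , q₁ , λ { (here e) → q₂ e ; (there i) → r i }

-- Injectivity of `φ` is asked only where `f` holds. Each step removes the image of one element from
-- `g`.
#-inject : ∀ {m n} (f : Fin m → Bool) (g : Fin n → Bool) (φ : Fin m → Fin n) →
           (∀ i → T (f i) → T (g (φ i))) →
           (∀ i j → T (f i) → T (f j) → φ i ≡ φ j → i ≡ j) → # f ≤ # g
#-inject {zero}  f g φ to inj = z≤n
#-inject {suc m} f g φ to inj with f zero in eq
... | false = #-inject (f ∘ suc) g (φ ∘ suc) (to ∘ suc)
                (λ i j p q e → suc-injective (inj (suc i) (suc j) p q e))
... | true  = ≤-trans
  (s≤s (#-inject (f ∘ suc) (g ∖ φ zero) (φ ∘ suc)
    (λ i p → ∖⁺ g (to (suc i) p) (λ e → contradiction (inj (suc i) zero p f₀ e) λ ()))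
    (λ i j p q e → suc-injective (inj (suc i) (suc j) p q e))))
  (#-remove g (φ zero) (to zero f₀))
  where
  f₀ : T (f zero)
  f₀ = Equivalence.from T-≡ eq

-- A choice adds at most `C` entries to the forbidden list and leaves one choice fewer, so the room
-- that is required does not grow.
room-step : ∀ {A : Set} F {C} (xs ys : List A) → length xs ≤ C →
            F * C + length (xs ++ ys) ≤ suc F * C + length ys
room-step F {C} xs ys p = begin
  F * C + length (xs ++ ys)          ≡⟨ cong (F * C +_) (length-++ xs) ⟩
  F * C + (length xs + length ys)    ≤⟨ +-monoʳ-≤ (F * C) (+-monoˡ-≤ (length ys) p) ⟩
  F * C + (C + length ys)            ≡⟨ sym (+-assoc (F * C) C (length ys)) ⟩
  F * C + C + length ys              ≡⟨ cong (_+ length ys) (+-comm (F * C) C) ⟩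
  C + F * C + length ys              ∎
  where open ≤-Reasoning

-- Greedy choice: c a lists what is in conflict with an earlier choice a.
choose : ∀ {N n C} {R : Fin n → Fin n → Set} → Symmetric R →
  (c : Fin n → List (Fin n)) → (∀ a → length (c a) ≤ C) → 1 ≤ C →
  (∀ {a b} → b ∉ˡ c a → R a b) →
  (f : Fin N → Bool) (g : Fin N → Fin n → Bool) (L : List (Fin n)) →
  (∀ i → T (f i) → # f * C + length L ≤ # (g i)) →
  (∀ i → ¬ T (f i) → Fin n) →
  ∃ λ (z : Fin N → Fin n) →
    (∀ i → T (f i) → T (g i (z i)) × z i ∉ˡ L) ×
    (∀ i j → T (f i) → T (f j) → i ≢ j → R (z i) (z j))
choose {zero} R-sym c c≤ 1≤C c-R f g L room dflt = (λ ()) , (λ ()) , λ ()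
choose {suc N} {n} {C} {R} R-sym c c≤ 1≤C c-R f g L room dflt with f zero in eq
... | false with z , z∈ , z-R ←
    choose {C = C} {R} R-sym c c≤ 1≤C c-R (f ∘ suc) (g ∘ suc) L (room ∘ suc) (dflt ∘ suc) =
  z′ , z′∈ , z′-R
  where
  ¬f₀ : ¬ T (f zero)
  ¬f₀ p = subst T eq p

  z′ : Fin (suc N) → Fin n
  -- Some value is needed even where nothing is chosen, and `Fin n` may be empty.
  z′ zero    = dflt zero (subst T eq)
  z′ (suc i) = z i

  z′∈ : ∀ i → T (f i) → T (g i (z′ i)) × z′ i ∉ˡ L
  z′∈ zero    p = contradiction p ¬f₀
  z′∈ (suc i) p = z∈ i p

  z′-R : ∀ i j → T (f i) → T (f j) → i ≢ j → R (z′ i) (z′ j)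
  z′-R zero    j       p q i≢j = contradiction p ¬f₀
  z′-R (suc i) zero    p q i≢j = contradiction q ¬f₀
  z′-R (suc i) (suc j) p q i≢j = z-R i j p q (i≢j ∘ cong suc)
-- As `1 ≤ C`, the set `g zero` has strictly more than `length L` elements.
... | true with a , ga , a∉ ← pick (g zero) L
                   (≤-trans (+-monoˡ-≤ (length L) (≤-trans 1≤C (m≤m+n C _)))
                            (room zero (Equivalence.from T-≡ eq)))
  with z , z∈ , z-R ← choose {C = C} {R} R-sym c c≤ 1≤C c-R (f ∘ suc) (g ∘ suc) (c a ++ L)
                        (λ i p → ≤-trans (room-step (# (f ∘ suc)) (c a) L (c≤ a)) (room (suc i) p))
                            (dflt ∘ suc) =
  z′ , z′∈ , z′-R
  where
  z′ : Fin (suc N) → Fin n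
  z′ zero    = a
  z′ (suc i) = z i

  z′∈ : ∀ i → T (f i) → T (g i (z′ i)) × z′ i ∉ˡ L
  z′∈ zero    p = ga , a∉
  z′∈ (suc i) p with gz , z∉ ← z∈ i p = gz , z∉ ∘ ∈-++⁺ʳ (c a)

  z′-R : ∀ i j → T (f i) → T (f j) → i ≢ j → R (z′ i) (z′ j)
  z′-R zero    zero    p q i≢j = contradiction refl i≢j
  z′-R zero    (suc j) p q i≢j = c-R (proj₂ (z∈ j q) ∘ ∈-++⁺ˡ)
  z′-R (suc i) zero    p q i≢j = R-sym (c-R (proj₂ (z∈ i p) ∘ ∈-++⁺ˡ))
  z′-R (suc i) (suc j) p q i≢j = z-R i j p q (i≢j ∘ cong suc)

-- The case of `choose` in which a choice is in conflict with itself only, so that `C` is 1.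
choose-distinct : ∀ {N n} (f : Fin N → Bool) (g : Fin N → Fin n → Bool) (L : List (Fin n)) →
  (∀ i → T (f i) → # f + length L ≤ # (g i)) →
  (∀ i → ¬ T (f i) → Fin n) →
  ∃ λ (z : Fin N → Fin n) →
    (∀ i → T (f i) → T (g i (z i)) × z i ∉ˡ L) ×
    (∀ i j → T (f i) → T (f j) → z i ≡ z j → i ≡ j)
choose-distinct f g L room dflt
  with z , z∈ , z≢ ← choose {C = 1} {_≢_} ≢-sym (_∷ []) (λ _ → ≤-refl) ≤-refl
                       (λ b∉ e → b∉ (here (sym e))) f g L
                       (λ i p → subst (λ m → m + length L ≤ # (g i)) (sym (*-identityʳ (# f)))
                           (room i p))
                       dflt =
  z , z∈ , λ i j p q e → inj i j p q e
  where
  inj : ∀ i j → T (f i) → T (f j) → z i ≡ z j → i ≡ j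
  inj i j p q e with i ≟ j
  ... | yes i≡j = i≡j
  ... | no i≢j  = contradiction e (z≢ i j p q i≢j)

-- Predicates as lists and vectors, degrees as counts.

members : ∀ {n} → (Fin n → Bool) → List (Fin n)
members {zero}  f = []
members {suc n} f with f zero
... | true  = zero ∷ List.map suc (members (f ∘ suc))
... | false = List.map suc (members (f ∘ suc))

length-members : ∀ {n} (f : Fin n → Bool) → length (members f) ≡ # f
length-members {zero}  f = refl
length-members {suc n} f with f zero
... | true  = cong suc (trans (length-map suc (members (f ∘ suc))) (length-members (f ∘ suc)))
... | false = trans (length-map suc (members (f ∘ suc))) (length-members (f ∘ suc))

∈-members : ∀ {n} (f : Fin n → Bool) {i} → T (f i) → i ∈ˡ members f
∈-members {suc n} f {zero}  p with f zero
... | true = here refl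
∈-members {suc n} f {suc i} p with f zero
... | true  = there (∈-map⁺ suc (∈-members (f ∘ suc) p))
... | false = ∈-map⁺ suc (∈-members (f ∘ suc) p)

∣tabulate∣ : ∀ {n} (f : Fin n → Bool) → ∣ tabulate f ∣ ≡ # f
∣tabulate∣ {zero}  f = refl
∣tabulate∣ {suc n} f with f zero
... | true  = cong suc (∣tabulate∣ (f ∘ suc))
... | false = ∣tabulate∣ (f ∘ suc)

sum-tabulate : ∀ {n} (f : Fin n → ℕ) → Vec.sum (tabulate f) ≡ ∑ f
sum-tabulate {zero}  f = refl
sum-tabulate {suc n} f = cong (f zero +_) (sum-tabulate (f ∘ suc))

∨⁻ : ∀ {a b} → T (a ∨ b) → T a ⊎ T b
∨⁻ = Equivalence.to T-∨

∨⁺ : ∀ {a b} → T a ⊎ T b → T (a ∨ b)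
∨⁺ = Equivalence.from T-∨

T⇒≡true : ∀ {b} → T b → b ≡ true
T⇒≡true = Equivalence.to T-≡

¬T⇒≡false : ∀ {b} → ¬ T b → b ≡ false
¬T⇒≡false {true}  p = ⊥-elim (p tt)
¬T⇒≡false {false} p = refl

Adj-sym : ∀ {n} (G : Graph n) {i j} → Adj G i j → Adj G j i
Adj-sym G {i} {j} = subst T (adj-sym G i j)

Adj-irrefl : ∀ {n} (G : Graph n) {i j} → Adj G i j → i ≢ j
Adj-irrefl G {i} p refl = subst T (adj-irrefl G i) p

degree-# : ∀ {n} (G : Graph n) i → degree G i ≡ # (adj G i)
degree-# G i = ∣tabulate∣ (adj G i)

-- Edge switches.

pair : ∀ {n} → Fin n → Fin n → Fin n → Bool
pair a b i = does (i ≟ a) ∨ does (i ≟ b)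

pair⁻ : ∀ {n} {a b i : Fin n} → T (pair a b i) → i ≡ a ⊎ i ≡ b
pair⁻ {a = a} {b} {i} p with ∨⁻ {does (i ≟ a)} p
... | inj₁ q = inj₁ (does⁻ (i ≟ a) q)
... | inj₂ q = inj₂ (does⁻ (i ≟ b) q)

pair⁺ˡ : ∀ {n} (a b : Fin n) → T (pair a b a)
pair⁺ˡ a b = ∨⁺ (inj₁ (does⁺ (a ≟ a) refl))

-- Toggling a pair on which f takes both values amounts to transposing it.
#-toggle : ∀ {n} (f : Fin n → Bool) {a b} → f a ≡ true → f b ≡ false →
           # (λ j → f j xor pair a b j) ≡ # f
#-toggle f {a} {b} fa fb = sym (trans (sum-permute (𝟙 ∘ f) (Perm.transpose a b))
  (sum-cong-≗ (λ j → cong 𝟙 (lemma j))))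
  where
  lemma : ∀ j → f (Perm.transpose a b Perm.⟨$⟩ʳ j) ≡ f j xor pair a b j
  lemma j with j ≟ a
  ... | yes refl rewrite fa | fb = refl
  ... | no j≢a with j ≟ b
  ...   | yes refl rewrite fa | fb = refl
  ...   | no j≢b with f j
  ...     | true  = refl
  ...     | false = refl

#-toggle′ : ∀ {n} (f : Fin n → Bool) {a b} → f a ≡ false → f b ≡ true →
            # (λ j → f j xor pair a b j) ≡ # f
#-toggle′ f {a} {b} fa fb = trans
  (sum-cong-≗ (λ j → cong (λ c → 𝟙 (f j xor c)) (∨-comm (does (j ≟ a)) (does (j ≟ b)))))
  (#-toggle f fb fa)

-- Replacing the edges ux and vy by uv and xy.
module Switch {n : ℕ} (G : Graph n) (u x v y : Fin n)
              (ux : Adj G u x) (vy : Adj G v y)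
              (¬uv : ¬ Adj G u v) (¬xy : ¬ Adj G x y)
              (u≢v : u ≢ v) (x≢y : x ≢ y) where

  -- The pairs with one end in {u, y} and the other in {v, x} are exactly uv, ux, vy and xy, so one
  -- formula covers the two removed and the two added edges.
  toggled : Fin n → Fin n → Bool
  toggled i j = (pair u y i ∧ pair v x j) ∨ (pair v x i ∧ pair u y j)

  toggled⁻ : ∀ {i j} → T (toggled i j) →
             ((i ≡ u ⊎ i ≡ y) × (j ≡ v ⊎ j ≡ x)) ⊎ ((i ≡ v ⊎ i ≡ x) × (j ≡ u ⊎ j ≡ y))
  toggled⁻ {i} {j} t with ∨⁻ {pair u y i ∧ pair v x j} t
  ... | inj₁ p with p₁ , p₂ ← ∧⁻ {pair u y i} p = inj₁ (pair⁻ p₁ , pair⁻ p₂)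
  ... | inj₂ p with p₁ , p₂ ← ∧⁻ {pair v x i} p = inj₂ (pair⁻ p₁ , pair⁻ p₂)

  disjoint : ∀ i → T (pair u y i) → ¬ T (pair v x i)
  disjoint i p q with pair⁻ {a = u} {y} {i} p | pair⁻ {a = v} {x} {i} q
  ... | inj₁ refl | inj₁ e    = u≢v e
  ... | inj₁ refl | inj₂ refl = Adj-irrefl G ux refl
  ... | inj₂ refl | inj₁ refl = Adj-irrefl G vy refl
  ... | inj₂ refl | inj₂ e    = x≢y (sym e)

  toggled-uy : ∀ {i} → T (pair u y i) → ∀ j → toggled i j ≡ pair v x j
  toggled-uy {i} p j rewrite T⇒≡true p | ¬T⇒≡false (disjoint i p)
    with pair v x j
  ... | true  = refl
  ... | false = refl

  toggled-vx : ∀ {i} → T (pair v x i) → ∀ j → toggled i j ≡ pair u y j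
  toggled-vx {i} p j rewrite T⇒≡true p | ¬T⇒≡false (λ q → disjoint i q p) = refl

  toggled-none : ∀ {i} → ¬ T (pair u y i) → ¬ T (pair v x i) → ∀ j → toggled i j ≡ false
  toggled-none p q j rewrite ¬T⇒≡false p | ¬T⇒≡false q = refl

  G′ : Graph n
  G′ = record
    { adj        = λ i j → adj G i j xor toggled i j
    ; adj-sym    = λ i j → cong₂ _xor_ (adj-sym G i j)
        (trans (∨-comm (pair u y i ∧ pair v x j) _)
               (cong₂ _∨_ (∧-comm (pair v x i) _) (∧-comm (pair u y i) _)))
    ; adj-irrefl = λ i → cong₂ _xor_ (adj-irrefl G i) (¬T⇒≡false (irrefl i))
    }
    where
    irrefl : ∀ i → ¬ T (toggled i i)
    irrefl i t with ∨⁻ {pair u y i ∧ pair v x i} t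
    ... | inj₁ p with p₁ , p₂ ← ∧⁻ {pair u y i} p = disjoint i p₁ p₂
    ... | inj₂ p with p₁ , p₂ ← ∧⁻ {pair v x i} p = disjoint i p₂ p₁

  unchanged : ∀ {i j} → ¬ T (toggled i j) → adj G′ i j ≡ adj G i j
  unchanged {i} {j} p rewrite ¬T⇒≡false p with adj G i j
  ... | true  = refl
  ... | false = refl

  uv′ : Adj G′ u v
  uv′ = subst T (sym (cong₂ _xor_ (¬T⇒≡false ¬uv) (toggled-uy {u} (pair⁺ˡ u y) v))) (pair⁺ˡ v x)

  -- The rows of u and y toggle at v and x, those of v and x at u and y. In each of them one of the
  -- two entries is an edge and the other is not, so the count is kept.
  row : ∀ i → # (adj G′ i) ≡ # (adj G i)
  row i with T? (pair u y i) | T? (pair v x i)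
  ... | yes p | _ = trans (sum-cong-≗ (λ j → cong (λ c → 𝟙 (adj G i j xor c)) (toggled-uy {i} p j)))
      (case (pair⁻ p))
    where
    case : i ≡ u ⊎ i ≡ y → # (λ j → adj G i j xor pair v x j) ≡ # (adj G i)
    case (inj₁ refl) = #-toggle′ (adj G i) (¬T⇒≡false ¬uv) (T⇒≡true ux)
    case (inj₂ refl) = #-toggle (adj G i) (T⇒≡true (Adj-sym G vy)) (¬T⇒≡false (¬xy ∘ Adj-sym G))
  ... | no _ | yes p = trans (sum-cong-≗
      (λ j → cong (λ c → 𝟙 (adj G i j xor c)) (toggled-vx {i} p j))) (case (pair⁻ p))
    where
    case : i ≡ v ⊎ i ≡ x → # (λ j → adj G i j xor pair u y j) ≡ # (adj G i)
    case (inj₁ refl) = #-toggle′ (adj G i) (¬T⇒≡false (¬uv ∘ Adj-sym G)) (T⇒≡true vy)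
    case (inj₂ refl) = #-toggle (adj G i) (T⇒≡true (Adj-sym G ux)) (¬T⇒≡false ¬xy)
  ... | no p | no q = sum-cong-≗
      (λ j → cong 𝟙 (unchanged {i} {j} (subst T (toggled-none {i} p q j))))

  degree-switch : ∀ i → degree G′ i ≡ degree G i
  degree-switch i = trans (degree-# G′ i) (trans (row i) (sym (degree-# G i)))

-- A missing edge between w p and w q is obtained by a switch that uses the edges from w p to
-- e p q and from w q to e q p; as these are different for different missing edges, the
-- switches do not interfere.
module _ {k n : ℕ} (H : Graph k) (w : Fin k → Fin n) (w-inj : Injective _≡_ _≡_ w)
         (e : Fin k → Fin k → Fin n) (Rel : Fin k → Fin k → Set)
         (e-inj : ∀ {p q p′ q′} → Rel p q → Rel p′ q′ → e p q ≡ e p′ q′ → p ≡ p′ × q ≡ q′)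
         (e∉w : ∀ {p q} → Rel p q → ∀ r → e p q ≢ w r) where

  -- The invariant under which every missing edge of the copy can be switched in. `Rel` singles out
  -- the pairs for which `e` is controlled; it has to cover only the missing edges.
  Ready : Graph n → Set
  Ready G = ∀ {p q} → Adj H p q → ¬ Adj G (w p) (w q) →
            Rel p q × Adj G (w p) (e p q) × ¬ Adj G (e p q) (e q p)

  module _ (G : Graph n) (ready : Ready G) {p q : Fin k} (pq : Adj H p q)
           (miss : ¬ Adj G (w p) (w q)) where

    private
      miss′ : ¬ Adj G (w q) (w p)
      miss′ = miss ∘ Adj-sym G

      Rpq : Rel p q
      Rpq = proj₁ (ready pq miss)

      Rqp : Rel q p
      Rqp = proj₁ (ready (Adj-sym H pq) miss′)

      open Switch G (w p) (e p q) (w q) (e q p)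
        (proj₁ (proj₂ (ready pq miss))) (proj₁ (proj₂ (ready (Adj-sym H pq) miss′)))
        miss (proj₂ (proj₂ (ready pq miss)))
        (Adj-irrefl H pq ∘ w-inj)
        (λ eq → Adj-irrefl H pq (proj₁ (e-inj Rpq Rqp eq)))

      -- Every toggled pair other than that of `w p` and `w q` contains `e p q` or `e q p`, neither
      -- of which is a vertex of the copy.
      old : ∀ {r s} → Adj G (w r) (w s) → Adj G′ (w r) (w s)
      old {r} {s} rs = subst T (sym (unchanged {_} {_} λ t → go (toggled⁻ t))) rs
        where
        go : ¬ (((w r ≡ w p ⊎ w r ≡ e q p) × (w s ≡ w q ⊎ w s ≡ e p q)) ⊎
                ((w r ≡ w q ⊎ w r ≡ e p q) × (w s ≡ w p ⊎ w s ≡ e q p)))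
        go (inj₁ (inj₂ a , _)) = e∉w Rqp r (sym a)
        go (inj₁ (_ , inj₂ b)) = e∉w Rpq s (sym b)
        go (inj₁ (inj₁ a , inj₁ b)) = miss (subst₂ (Adj G) a b rs)
        go (inj₂ (inj₂ a , _)) = e∉w Rpq r (sym a)
        go (inj₂ (_ , inj₂ b)) = e∉w Rqp s (sym b)
        go (inj₂ (inj₁ a , inj₁ b)) = miss′ (subst₂ (Adj G) a b rs)

      -- A pair that is still missing is not the one just treated, in either order, so by `e-inj`
      -- and `e∉w` the vertex `e r s` lies outside the four vertices of the switch. No pair at
      -- `e r s` has been toggled.
      ready′ : Ready G′
      ready′ {r} {s} rs miss-rs with R , adj-we , ¬adj-ee ← ready rs (miss-rs ∘ old) =
        R , subst T (sym (unchanged {_} {_} λ t → go₁ (toggled⁻ t))) adj-we ,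
        λ a → ¬adj-ee (subst T (unchanged {_} {_} λ t → go₂ (toggled⁻ t)) a)
        where
        new : e r s ≢ e p q
        new eq with refl , refl ← e-inj R Rpq eq = miss-rs uv′

        new′ : e r s ≢ e q p
        new′ eq with refl , refl ← e-inj R Rqp eq = miss-rs (Adj-sym G′ uv′)

        go₁ : ¬ (((w r ≡ w p ⊎ w r ≡ e q p) × (e r s ≡ w q ⊎ e r s ≡ e p q)) ⊎
                 ((w r ≡ w q ⊎ w r ≡ e p q) × (e r s ≡ w p ⊎ e r s ≡ e q p)))
        go₁ (inj₁ (_ , inj₁ b)) = e∉w R q b
        go₁ (inj₁ (_ , inj₂ b)) = new b
        go₁ (inj₂ (_ , inj₁ b)) = e∉w R p b
        go₁ (inj₂ (_ , inj₂ b)) = new′ b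

        go₂ : ¬ (((e r s ≡ w p ⊎ e r s ≡ e q p) × (e s r ≡ w q ⊎ e s r ≡ e p q)) ⊎
                 ((e r s ≡ w q ⊎ e r s ≡ e p q) × (e s r ≡ w p ⊎ e s r ≡ e q p)))
        go₂ (inj₁ (inj₁ a , _)) = e∉w R p a
        go₂ (inj₁ (inj₂ a , _)) = new′ a
        go₂ (inj₂ (inj₁ a , _)) = e∉w R q a
        go₂ (inj₂ (inj₂ a , _)) = new a

    add-edge : ∃ λ G″ → (∀ i → degree G″ i ≡ degree G i) × Ready G″ ×
                 Adj G″ (w p) (w q) × (∀ {r s} → Adj G (w r) (w s) → Adj G″ (w r) (w s))
    add-edge = G′ , degree-switch , ready′ , uv′ , old

  -- Invariant: a pair is still to come in `ps` or its edge, if required, is already there. A later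
  -- switch destroys no edge between vertices of the copy.
  add-edges : (ps : List (Fin k × Fin k)) (G : Graph n) → Ready G →
    (∀ p q → (p , q) ∈ˡ ps ⊎ (Adj H p q → Adj G (w p) (w q))) →
    ∃ λ G′ → (∀ i → degree G′ i ≡ degree G i) × (∀ p q → Adj H p q → Adj G′ (w p) (w q))
  add-edges [] G ready done = G , (λ _ → refl) , λ p q → [ (λ ()) , id ]′ (done p q)
  add-edges ((p , q) ∷ ps) G ready done with T? (adj H p q) | T? (adj G (w p) (w q))
  ... | yes pq | no miss
    with G′ , deg , ready′ , wpq , old ← add-edge G ready pq miss
    with G″ , deg′ , all ← add-edges ps G′ ready′
           (λ r s → [ (λ { (here refl) → inj₂ (λ _ → wpq) ; (there i) → inj₁ i }) ,
               (λ f → inj₂ (old ∘ f)) ]′ (done r s)) =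
    G″ , (λ i → trans (deg′ i) (deg i)) , all
  ... | no ¬pq | _ = add-edges ps G ready
           (λ r s → [ (λ { (here refl) → inj₂ (λ pq → contradiction pq ¬pq) ; (there i) → inj₁ i })
               , inj₂ ]′ (done r s))
  ... | yes _ | yes wpq = add-edges ps G ready
           (λ r s → [ (λ { (here refl) → inj₂ (λ _ → wpq) ; (there i) → inj₁ i }) ,
               inj₂ ]′ (done r s))

  ready⇒potentially : ∀ G → Ready G → PotentiallyGraphic H (degrees G)
  ready⇒potentially G ready
    with G′ , deg , all ← add-edges (cartesianProduct (allFin k) (allFin k)) G ready
           (λ p q → inj₁ (∈-cartesianProduct⁺ (∈-allFin p) (∈-allFin q))) =
    G′ , tabulate-cong deg , w , w-inj , all

-- A copy of `H` from `k` vertices of large degree.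

dichotomy : ∀ {k} {P : Fin k → Fin k → Set} → (∀ p q → Dec (P p q)) →
            (∀ p q → P p q) ⊎ ∃₂ λ p q → ¬ P p q
dichotomy {k} {P} P? with all? (λ p → all? (P? p))
... | yes all = inj₁ all
... | no ¬all
  with p , ¬p ← ¬∀⟶∃¬ k (λ p → ∀ q → P p q) (λ p → all? (P? p)) ¬all
  with q , ¬q ← ¬∀⟶∃¬ k (P p) (P? p) ¬p = inj₂ (p , q , ¬q)

-- Both orders of a pair have to use the same witness, two nonadjacent vertices. The flag tells
-- which of the two is meant.
oriented : ∀ {k} → Fin k → Fin k → Bool × Fin k × Fin k
oriented p q with p Fin.<? q
... | yes _ = true , p , q
... | no  _ = false , q , p

oriented-injective : ∀ {k} (p q p′ q′ : Fin k) → oriented p q ≡ oriented p′ q′ → p ≡ p′ × q ≡ q′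
oriented-injective p q p′ q′ eq with p Fin.<? q | p′ Fin.<? q′
oriented-injective p q p′ q′ refl | yes _ | yes _ = refl , refl
oriented-injective p q p′ q′ refl | no _  | no _  = refl , refl

oriented-swap : ∀ {k} (p q : Fin k) → p ≢ q →
  (oriented p q ≡ (true , p , q) × oriented q p ≡ (false , p , q)) ⊎
  (oriented p q ≡ (false , q , p) × oriented q p ≡ (true , q , p))
oriented-swap p q p≢q with p Fin.<? q | q Fin.<? p
... | yes p<q | yes q<p = contradiction q<p (ℕ.<-asym p<q)
... | yes p<q | no  _   = inj₁ (refl , refl)
... | no  _   | yes q<p = inj₂ (refl , refl)
... | no p≮q  | no q≮p  =
    contradiction (Fin.toℕ-injective (ℕ.≤-antisym (ℕ.≮⇒≥ q≮p) (ℕ.≮⇒≥ p≮q))) p≢q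

-- The side `b` falls into `k * k` disjoint blocks of `k` vertices. A block that is a clique
-- contains `H`. If there is none, each block has a missing edge, and its ends, being joined to all
-- of `a`, serve to switch in an edge between two vertices of `a`.
complete-bipartite⇒potentially : ∀ {k n} (H : Graph k) (G : Graph n)
  (a : Fin k → Fin n) (b : Fin (k * (k * k)) → Fin n) →
  Injective _≡_ _≡_ a → Injective _≡_ _≡_ b → (∀ i j → Adj G (a i) (b j)) →
  PotentiallyGraphic H (degrees G)
complete-bipartite⇒potentially {k} {n} H G a b a-inj b-inj ab =
  [ go , clique ]′ (dichotomy (λ p q → any? λ i → any? λ j →
       ¬? (i ≟ j) ×-dec ¬? (T? (adj G (block p q i) (block p q j)))))
  where
  block : Fin k → Fin k → Fin k → Fin n
  block p q i = b (combine p (combine q i))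

  block-inj : ∀ {p q i p′ q′ i′} → block p q i ≡ block p′ q′ i′ → p ≡ p′ × q ≡ q′ × i ≡ i′
  block-inj {p} {q} {i} {p′} {q′} {i′} eq
    with p≡ , eq′ ← combine-injective p (combine q i) p′ (combine q′ i′) (b-inj eq)
    = p≡ , combine-injective q i q′ i′ eq′

  Good : Fin k → Fin k → Set
  Good p q = ∃₂ λ i j → i ≢ j × ¬ Adj G (block p q i) (block p q j)

  clique : (∃₂ λ p q → ¬ Good p q) → PotentiallyGraphic H (degrees G)
  clique (p , q , ¬good) = G , refl , block p q , (λ eq → proj₂ (proj₂ (block-inj eq))) ,
    λ i j ij → decidable-stable (T? _) λ ¬adj → ¬good (i , j , Adj-irrefl H ij , ¬adj)

  go : (∀ p q → Good p q) → PotentiallyGraphic H (degrees G)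
  go good = ready⇒potentially H a a-inj e _≢_ (λ _ _ → e-inj) (λ {p} {q} _ → e∉a {p} {q}) G ready
    where
    end : Bool → Fin k → Fin k → Fin k
    end true  p q = proj₁ (good p q)
    end false p q = proj₁ (proj₂ (good p q))

    end-inj : ∀ c c′ p q → end c p q ≡ end c′ p q → c ≡ c′
    end-inj true  true  p q eq = refl
    end-inj true  false p q eq = contradiction eq (proj₁ (proj₂ (proj₂ (good p q))))
    end-inj false true  p q eq = contradiction (sym eq) (proj₁ (proj₂ (proj₂ (good p q))))
    end-inj false false p q eq = refl

    ε : Bool × Fin k × Fin k → Fin n
    ε (c , p , q) = block p q (end c p q)

    ε-inj : ∀ t t′ → ε t ≡ ε t′ → t ≡ t′
    ε-inj (c , p , q) (c′ , p′ , q′) eq with refl , refl , ends ← block-inj {p} {q} {_} {p′} {q′} eq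
      with refl ← end-inj c c′ p q ends = refl

    e : Fin k → Fin k → Fin n
    e p q = ε (oriented p q)

    e-inj : ∀ {p q p′ q′} → e p q ≡ e p′ q′ → p ≡ p′ × q ≡ q′
    e-inj eq = oriented-injective _ _ _ _ (ε-inj _ _ eq)

    e∉a : ∀ {p q} r → e p q ≢ a r
    e∉a r eq = Adj-irrefl G (ab r _) (sym eq)

    ready : ∀ {p q} → Adj H p q → ¬ Adj G (a p) (a q) →
            p ≢ q × Adj G (a p) (e p q) × ¬ Adj G (e p q) (e q p)
    ready {p} {q} pq _ = Adj-irrefl H pq , ab p _ , nonadj (oriented-swap p q (Adj-irrefl H pq))
      where
      nonadj : _ → ¬ Adj G (e p q) (e q p)
      nonadj (inj₁ (o₁ , o₂)) = subst₂ (λ t t′ → ¬ Adj G (ε t) (ε t′)) (sym o₁) (sym o₂)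
        (proj₂ (proj₂ (proj₂ (good p q))))
      nonadj (inj₂ (o₁ , o₂)) = subst₂ (λ t t′ → ¬ Adj G (ε t) (ε t′)) (sym o₁) (sym o₂)
        (proj₂ (proj₂ (proj₂ (good q p))) ∘ Adj-sym G)

-- k vertices for a copy of H, and k common neighbours for each ordered pair of them.
blockSize : ℕ → ℕ
blockSize k = k + k * (k * k)

-- Room for `k * k` disjoint blocks of neighbours that avoid `k` given vertices.
large : ℕ → ℕ
large k = k * (k * blockSize k) + k

-- Choose disjoint blocks `β p q` of neighbours of `w p`. A missing edge between `β p q` and `β q p`
-- allows a switch that joins `w p` and `w q`. If for some p and q there is none, the two blocks are
-- completely joined, and parts of them form the complete bipartite graph of the previous lemma.
large-degrees⇒potentially : ∀ {k n} (H : Graph k) (G : Graph n) (w : Fin k → Fin n) →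
  Injective _≡_ _≡_ w → (∀ p → large k ≤ degree G (w p)) → PotentiallyGraphic H (degrees G)
large-degrees⇒potentially {k} {n} H G w w-inj deg =
  conclude (choose-distinct {k * (k * blockSize k)} (λ _ → true) nbr (List.tabulate w)
    (λ t _ → subst₂ _≤_
      (cong₂ _+_ (sym (#-const (k * (k * blockSize k)))) (sym (length-tabulate w)))
      (degree-# G _) (deg _))
    (λ _ ¬t → ⊥-elim (¬t tt)))
  where
  nbr : Fin (k * (k * blockSize k)) → Fin n → Bool
  nbr t = adj G (w (proj₁ (remQuot (k * blockSize k) t)))

  conclude : (∃ λ (z : Fin (k * (k * blockSize k)) → Fin n) →
      (∀ i → T true → T (nbr i (z i)) × z i ∉ˡ List.tabulate w) ×
      (∀ i j → T true → T true → z i ≡ z j → i ≡ j)) → PotentiallyGraphic H (degrees G)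
  conclude (z , z∈ , z-inj) = [ go , bipartite ]′ (dichotomy (λ p q → any? λ i → any? λ j →
       ¬? (T? (adj G (β p q i) (β q p j)))))
    where
    β : Fin k → Fin k → Fin (blockSize k) → Fin n
    β p q i = z (combine p (combine q i))

    β-inj : ∀ {p q i p′ q′ i′} → β p q i ≡ β p′ q′ i′ → p ≡ p′ × q ≡ q′ × i ≡ i′
    β-inj {p} {q} {i} {p′} {q′} {i′} eq
      with p≡ , eq′ ← combine-injective p (combine q i) p′ (combine q′ i′) (z-inj _ _ tt tt eq)
      = p≡ , combine-injective q i q′ i′ eq′

    Good : Fin k → Fin k → Set
    Good p q = ∃₂ λ i j → ¬ Adj G (β p q i) (β q p j)

    bipartite : (∃₂ λ p q → ¬ Good p q) → PotentiallyGraphic H (degrees G)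
    bipartite (p , q , ¬good) = complete-bipartite⇒potentially H G
      (λ i → β p q (i ↑ˡ (k * (k * k)))) (λ j → β q p (k ↑ʳ j))
      (λ eq → ↑ˡ-injective _ _ _ (proj₂ (proj₂ (β-inj {p} {q} eq))))
      (λ eq → ↑ʳ-injective k _ _ (proj₂ (proj₂ (β-inj {q} {p} eq))))
      (λ i j → decidable-stable (T? _) λ ¬adj → ¬good (_ , _ , ¬adj))

    go : (∀ p q → Good p q) → PotentiallyGraphic H (degrees G)
    go good = ready⇒potentially H w w-inj e _≢_
                (λ {p} {q} {p′} {q′} _ _ eq → e-inj {p} {q} {p′} {q′} eq)
                (λ {p} {q} _ r eq → proj₂ (z∈ (combine p (combine q _)) tt)
                   (subst (_∈ˡ List.tabulate w) (sym eq) (∈-tabulate⁺ r)))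
                G ready
      where
      end : Bool × Fin k × Fin k → Fin (blockSize k)
      end (true  , p , q) = proj₁ (good p q)
      end (false , p , q) = proj₁ (proj₂ (good p q))

      e : Fin k → Fin k → Fin n
      e p q = β p q (end (oriented p q))

      e-inj : ∀ {p q p′ q′} → e p q ≡ e p′ q′ → p ≡ p′ × q ≡ q′
      e-inj {p} {q} {p′} {q′} eq with p≡ , q≡ , _ ← β-inj {p} {q} {_} {p′} {q′} eq = p≡ , q≡

      ready : ∀ {p q} → Adj H p q → ¬ Adj G (w p) (w q) →
              p ≢ q × Adj G (w p) (e p q) × ¬ Adj G (e p q) (e q p)
      ready {p} {q} pq _ = Adj-irrefl H pq ,
        subst (λ r → Adj G (w (proj₁ r)) (e p q)) (remQuot-combine p _)
          (proj₁ (z∈ (combine p (combine q _)) tt)) ,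
        nonadj (oriented-swap p q (Adj-irrefl H pq))
        where
        nonadj : _ → ¬ Adj G (e p q) (e q p)
        nonadj (inj₁ (o₁ , o₂)) =
            subst₂ (λ t t′ → ¬ Adj G (β p q (end t)) (β q p (end t′))) (sym o₁) (sym o₂)
          (proj₂ (proj₂ (good p q)))
        nonadj (inj₂ (o₁ , o₂)) =
            subst₂ (λ t t′ → ¬ Adj G (β p q (end t)) (β q p (end t′))) (sym o₁) (sym o₂)
          (proj₂ (proj₂ (good q p)) ∘ Adj-sym G)

-- A copy of `H` from far apart small vertices with common large neighbours.

T-em : ∀ b → T b ⊎ T (not b)
T-em true  = inj₁ tt
T-em false = inj₂ tt

if-T : ∀ {A : Set} {b} {x y : A} → T b → (if b then x else y) ≡ x
if-T {b = true} _ = refl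

if-F : ∀ {A : Set} {b} {x y : A} → T (not b) → (if b then x else y) ≡ y
if-F {b = false} _ = refl

module Partition {n : ℕ} (G : Graph n) (small : Fin n → Bool) where

  adjˢ : Fin n → Fin n → Bool
  adjˢ a b = small a ∧ (small b ∧ adj G a b)

  adjᴸ : Fin n → Fin n → Bool
  adjᴸ a b = not (small b) ∧ adj G a b

  adjˢ⁻ : ∀ {a b} → T (adjˢ a b) → T (small a) × T (small b) × Adj G a b
  adjˢ⁻ {a} {b} p with p₁ , p₂ ← ∧⁻ {small a} p = p₁ , ∧⁻ {small b} p₂

  adjˢ⁺ : ∀ {a b} → T (small a) → T (small b) → Adj G a b → T (adjˢ a b)
  adjˢ⁺ p q r = ∧⁺ p (∧⁺ q r)

  -- Distance at least 4 in the graph induced on the small vertices.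
  record Far (a b : Fin n) : Set where
    field
      distinct    : a ≢ b
      nonadjacent : ¬ T (adjˢ a b)
      separated  : ∀ {x y} → T (adjˢ a x) → T (adjˢ b y) → x ≢ y × ¬ T (adjˢ x y)

  adjˢ-sym : ∀ {a b} → T (adjˢ a b) → T (adjˢ b a)
  adjˢ-sym p with p₁ , p₂ , p₃ ← adjˢ⁻ p = adjˢ⁺ p₂ p₁ (Adj-sym G p₃)

  Far-sym : Symmetric Far
  Far-sym far = record
    { distinct    = distinct ∘ sym
    ; nonadjacent = nonadjacent ∘ adjˢ-sym
    ; separated  = λ p q → proj₁ (separated q p) ∘ sym , proj₂ (separated q p) ∘ adjˢ-sym
    }
    where open Far far

  neighboursˢ : Fin n → List (Fin n)
  neighboursˢ a = members (adjˢ a)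

  grow : List (Fin n) → List (Fin n)
  grow L = L ++ concatMap neighboursˢ L

  ball : ℕ → Fin n → List (Fin n)
  ball zero    a = a ∷ []
  ball (suc r) a = grow (ball r a)

  ball-⊆ : ∀ r {a b} → b ∈ˡ ball r a → b ∈ˡ ball (suc r) a
  ball-⊆ r {a} = ∈-++⁺ˡ {xs = ball r a}

  ball-adj : ∀ r {a b c} → b ∈ˡ ball r a → T (adjˢ b c) → c ∈ˡ ball (suc r) a
  ball-adj r {a} {b} {c} b∈ bc = ∈-++⁺ʳ (ball r a) (go (ball r a) b∈)
    where
    go : ∀ L → b ∈ˡ L → c ∈ˡ concatMap neighboursˢ L
    go (d ∷ L) (here refl) = ∈-++⁺ˡ (∈-members (adjˢ b) bc)
    go (d ∷ L) (there i)   = ∈-++⁺ʳ (neighboursˢ d) (go L i)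

  -- Each way of not being far apart gives a walk of length at most 3 from `a` to `b` through small
  -- vertices.
  ∉ball⇒Far : ∀ {a b} → b ∉ˡ ball 3 a → Far a b
  ∉ball⇒Far {a} {b} b∉ = record
    { distinct    = λ { refl → b∉ (ball-⊆ 2 (ball-⊆ 1 (ball-⊆ 0 centre))) }
    ; nonadjacent = λ ab → b∉ (ball-⊆ 2 (ball-⊆ 1 (ball-adj 0 centre ab)))
    ; separated   = λ ax by →
        (λ { refl → b∉ (ball-⊆ 2 (ball-adj 1 (ball-adj 0 centre ax) (adjˢ-sym by))) }) ,
        λ xy → b∉ (ball-adj 2 (ball-adj 1 (ball-adj 0 centre ax) xy) (adjˢ-sym by))
    }
    where
    centre : a ∈ˡ ball 0 a
    centre = here refl

  module _ {D : ℕ} (bound : ∀ a → # (adjˢ a) ≤ D) where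

    length-grow : ∀ L → length (grow L) ≤ length L * suc D
    length-grow L = begin
      length (L ++ concatMap neighboursˢ L)        ≡⟨ length-++ L ⟩
      length L + length (concatMap neighboursˢ L)  ≤⟨ +-monoʳ-≤ (length L) (go L) ⟩
      length L + length L * D                      ≡⟨ sym (*-suc (length L) D) ⟩
      length L * suc D                             ∎
      where
      open ≤-Reasoning
      go : ∀ L → length (concatMap neighboursˢ L) ≤ length L * D
      go []      = z≤n
      go (a ∷ L) = begin
        length (neighboursˢ a ++ concatMap neighboursˢ L)          ≡⟨ length-++ (neighboursˢ a) ⟩
        length (neighboursˢ a) + length (concatMap neighboursˢ L)
          ≡⟨ cong (_+ _) (length-members (adjˢ a)) ⟩
        # (adjˢ a) + length (concatMap neighboursˢ L)              ≤⟨ +-mono-≤ (bound a) (go L) ⟩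
        D + length L * D                                           ∎

    length-ball : ∀ r a → length (ball r a) ≤ suc D ^ r
    length-ball zero    a = ≤-refl
    length-ball (suc r) a = begin
      length (grow (ball r a))     ≤⟨ length-grow (ball r a) ⟩
      length (ball r a) * suc D    ≤⟨ *-monoˡ-≤ (suc D) (length-ball r a) ⟩
      suc D ^ r * suc D            ≡⟨ *-comm (suc D ^ r) (suc D) ⟩
      suc D * suc D ^ r            ∎
      where open ≤-Reasoning

    -- A chosen vertex rules out only its ball of radius 3, which has at most `suc D ^ 3` entries.
    choose-far : ∀ {N} (P : Fin n → Bool) → N * suc D ^ 3 ≤ # P →
                 ∃ λ (z : Fin N → Fin n) → (∀ i → T (P (z i))) × (∀ i j → i ≢ j → Far (z i) (z j))
    choose-far {N} P room
      with z , z∈ , far ← choose {N} {C = suc D ^ 3} {R = Far} Far-sym (ball 3) (length-ball 3)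
                            (m^n>0 (suc D) 3) ∉ball⇒Far
                            (λ _ → true) (λ _ → P) []
                            (λ _ _ → subst (_≤ # P)
                              (trans (cong (_* suc D ^ 3) (sym (#-const N))) (sym (+-identityʳ _)))
                              room)
                            (λ _ ¬t → ⊥-elim (¬t tt)) =
      z , (λ i → proj₁ (z∈ i tt)) , λ i j → far i j tt tt

  -- The vertices of H in S are placed at z (combine zero _), the others at common large
  -- neighbours of all z i, which a switch with the remaining z i completes to a clique.
  module _ {k : ℕ} (H : Graph k) (S : Fin k → Bool) (v : Fin n)
           (z : Fin (suc k * k) → Fin n)
           (z-small : ∀ i → T (small (z i)))
           (z-far : ∀ i j → i ≢ j → Far (z i) (z j))
           (z-large : ∀ i l → T (adjᴸ v l) → Adj G (z i) l)
           (S-large : # (not ∘ S) ≤ # (adjᴸ v))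
           (S-small : ∀ i p → T (S p) → # (λ q → S q ∧ adj H p q) ≤ # (adjˢ (z i))) where

    private
      index : Fin (suc k) → Fin k → Fin (suc k * k)
      index = combine

      zˢ : Fin k → Fin n
      zˢ p = z (index zero p)

      zᴸ : Fin k → Fin k → Fin n
      zᴸ p q = z (index (suc p) q)

      z-inj : ∀ p q p′ q′ → z (index p q) ≡ z (index p′ q′) → p ≡ p′ × q ≡ q′
      z-inj p q p′ q′ eq with index p q ≟ index p′ q′
      ... | yes eq′ = combine-injective p q p′ q′ eq′
      ... | no  neq = contradiction eq (Far.distinct (z-far _ _ neq))

      far : ∀ p q p′ q′ → ¬ (p ≡ p′ × q ≡ q′) → Far (z (index p q)) (z (index p′ q′))
      far p q p′ q′ neq = z-far _ _ (neq ∘ combine-injective p q p′ q′)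

      mask : Fin k → Fin k → Bool
      mask p q = S p ∧ (S q ∧ adj H p q)

      τ-spec : ∃ λ (τ : Fin k → Fin n) →
        (∀ p → T (not (S p)) → T (adjᴸ v (τ p)) × τ p ∉ˡ []) ×
        (∀ p q → T (not (S p)) → T (not (S q)) → τ p ≡ τ q → p ≡ q)
      τ-spec = choose-distinct (not ∘ S) (λ _ → adjᴸ v) []
        (λ _ _ → subst (_≤ # (adjᴸ v)) (sym (+-identityʳ _)) S-large) (λ _ _ → v)

      τ : Fin k → Fin n
      τ = proj₁ τ-spec

      -- For p in `S`, a separate small neighbour of `zˢ p` for each neighbour of p inside `S`;
      -- these are used up by the switches at `zˢ p`.
      ξ-spec : ∀ p → ∃ λ (ξ : Fin k → Fin n) →
        (∀ q → T (mask p q) → T (adjˢ (zˢ p) (ξ q)) × ξ q ∉ˡ []) ×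
        (∀ q q′ → T (mask p q) → T (mask p q′) → ξ q ≡ ξ q′ → q ≡ q′)
      ξ-spec p = choose-distinct (mask p) (λ _ → adjˢ (zˢ p)) []
        (λ q m → subst (_≤ # (adjˢ (zˢ p))) (sym (+-identityʳ _))
          (≤-trans (#-mono {f = mask p} (λ r → proj₂ ∘ ∧⁻ {S p}))
              (S-small _ p (proj₁ (∧⁻ {S p} m)))))
        (λ _ _ → v)

      ξ : Fin k → Fin k → Fin n
      ξ p = proj₁ (ξ-spec p)

      w : Fin k → Fin n
      w p = if S p then zˢ p else τ p

      -- Outside `S` no private neighbours are needed: every spare vertex `zᴸ p q` is adjacent to
      -- all the vertices `τ`.
      e : Fin k → Fin k → Fin n
      e p q = if S p then ξ p q else zᴸ p q

      side : ∀ p → (T (S p) × w p ≡ zˢ p × (∀ q → e p q ≡ ξ p q)) ⊎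
                   (T (not (S p)) × w p ≡ τ p × (∀ q → e p q ≡ zᴸ p q))
      side p = Sum.map (λ p∈ → p∈ , if-T p∈ , λ _ → if-T p∈) (λ p∉ → p∉ , if-F p∉ , λ _ → if-F p∉)
          (T-em (S p))

      τ-large : ∀ {p} → T (not (S p)) → ¬ T (small (τ p))
      τ-large {p} p∉S = T-not⁻ (proj₁ (∧⁻ {not (small (τ p))} (proj₁ (proj₁ (proj₂ τ-spec) p p∉S))))

      τ-adj : ∀ {p} → T (not (S p)) → ∀ i → Adj G (z i) (τ p)
      τ-adj {p} p∉S i = z-large i (τ p) (proj₁ (proj₁ (proj₂ τ-spec) p p∉S))

      z≢τ : ∀ {p} → T (not (S p)) → ∀ i → z i ≢ τ p
      z≢τ p∉S i eq = τ-large p∉S (subst (T ∘ small) eq (z-small i))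

      ξ-adj : ∀ {p q} → T (mask p q) → T (adjˢ (zˢ p) (ξ p q))
      ξ-adj {p} {q} m = proj₁ (proj₁ (proj₂ (ξ-spec p)) q m)

      ξ-small : ∀ {p q} → T (mask p q) → T (small (ξ p q))
      ξ-small m = proj₁ (proj₂ (adjˢ⁻ (ξ-adj m)))

      -- Edges between `S` and its complement are present from the start, so switches are made only
      -- within one of the two parts.
      Rel : Fin k → Fin k → Set
      Rel p q = Adj H p q × S p ≡ S q

      Rel⇒mask : ∀ {p q} → T (S p) → Rel p q → T (mask p q)
      Rel⇒mask p∈S (pq , eq) = ∧⁺ p∈S (∧⁺ (subst T eq p∈S) pq)

      w-inj : Injective _≡_ _≡_ w
      w-inj {p} {q} eq with side p | side q
      ... | inj₁ (_ , wp , _)   | inj₁ (_ , wq , _)   =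
          proj₂ (z-inj zero p zero q (trans (sym wp) (trans eq wq)))
      ... | inj₁ (_ , wp , _)   | inj₂ (q∉ , wq , _)  =
          contradiction (trans (sym wp) (trans eq wq)) (z≢τ q∉ _)
      ... | inj₂ (p∉ , wp , _)  | inj₁ (_ , wq , _)   =
          contradiction (sym (trans (sym wp) (trans eq wq))) (z≢τ p∉ _)
      ... | inj₂ (p∉ , wp , _)  | inj₂ (q∉ , wq , _)  =
          proj₂ (proj₂ τ-spec) p q p∉ q∉ (trans (sym wp) (trans eq wq))

      ξ≢z : ∀ {p q} → T (mask p q) → ∀ p′ q′ → ξ p q ≢ z (index p′ q′)
      ξ≢z {p} {q} m p′ q′ eq with index zero p ≟ index p′ q′
      ... | yes eq′ = Adj-irrefl G (proj₂ (proj₂ (adjˢ⁻ (ξ-adj m))))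
          (sym (trans eq (cong z (sym eq′))))
      ... | no neq  = Far.nonadjacent (z-far _ _ neq) (subst (T ∘ adjˢ (zˢ p)) eq (ξ-adj m))

      e-inj : ∀ {p q p′ q′} → Rel p q → Rel p′ q′ → e p q ≡ e p′ q′ → p ≡ p′ × q ≡ q′
      e-inj {p} {q} {p′} {q′} R R′ eq with side p | side p′
      ... | inj₁ (p∈ , _ , ep) | inj₁ (p′∈ , _ , ep′) with p ≟ p′
      ...   | yes refl = refl , proj₂ (proj₂ (ξ-spec p)) q q′ (Rel⇒mask p∈ R) (Rel⇒mask p′∈ R′)
                                  (trans (sym (ep q)) (trans eq (ep q′)))
      -- Far apart vertices have no common small neighbour.
      ...   | no p≢p′  = contradiction (trans (sym (ep q)) (trans eq (ep′ q′)))
                           (proj₁ (Far.separated (far zero p zero p′ (p≢p′ ∘ proj₂))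
                               (ξ-adj (Rel⇒mask p∈ R)) (ξ-adj (Rel⇒mask p′∈ R′))))
      e-inj {p} {q} {p′} {q′} R R′ eq | inj₁ (p∈ , _ , ep) | inj₂ (_ , _ , ep′) =
        contradiction (trans (sym (ep q)) (trans eq (ep′ q′))) (ξ≢z (Rel⇒mask p∈ R) (suc p′) q′)
      e-inj {p} {q} {p′} {q′} R R′ eq | inj₂ (_ , _ , ep) | inj₁ (p′∈ , _ , ep′) =
        contradiction (sym (trans (sym (ep q)) (trans eq (ep′ q′))))
            (ξ≢z (Rel⇒mask p′∈ R′) (suc p) q)
      e-inj {p} {q} {p′} {q′} R R′ eq | inj₂ (_ , _ , ep) | inj₂ (_ , _ , ep′)
        with p≡ , q≡ ← z-inj (suc p) q (suc p′) q′ (trans (sym (ep q)) (trans eq (ep′ q′))) =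
            suc-injective p≡ , q≡

      e∉w : ∀ {p q} → Rel p q → ∀ r → e p q ≢ w r
      e∉w {p} {q} R r eq with side p | side r
      ... | inj₁ (p∈ , _ , ep) | inj₁ (_ , wr , _)  =
          ξ≢z (Rel⇒mask p∈ R) zero r (trans (sym (ep q)) (trans eq wr))
      ... | inj₁ (p∈ , _ , ep) | inj₂ (r∉ , wr , _) =
          τ-large r∉ (subst (T ∘ small) (trans (sym (ep q)) (trans eq wr))
          (ξ-small (Rel⇒mask p∈ R)))
      ... | inj₂ (_ , _ , ep)  | inj₁ (_ , wr , _)
        with () ← proj₁ (z-inj (suc p) q zero r (trans (sym (ep q)) (trans eq wr)))
      ... | inj₂ (_ , _ , ep)  | inj₂ (r∉ , wr , _) = z≢τ r∉ _ (trans (sym (ep q)) (trans eq wr))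

      -- Inside `S`, the vertices `ξ p q` and `ξ q p` are nonadjacent because `zˢ p` and `zˢ q` have
      -- distance at least 4. Outside `S`, two different spare vertices are far apart themselves.
      ready : ∀ {p q} → Adj H p q → ¬ Adj G (w p) (w q) →
              Rel p q × Adj G (w p) (e p q) × ¬ Adj G (e p q) (e q p)
      ready {p} {q} pq miss with side p | side q
      ... | inj₁ (p∈ , wp , ep) | inj₁ (q∈ , wq , eq) =
        Rpq ,
        subst₂ (Adj G) (sym wp) (sym (ep q)) (proj₂ (proj₂ (adjˢ⁻ (ξ-adj m)))) ,
        λ a → proj₂ (Far.separated (far zero p zero q (Adj-irrefl H pq ∘ proj₂)) (ξ-adj m)
            (ξ-adj m′))
                (adjˢ⁺ (ξ-small m) (ξ-small m′) (subst₂ (Adj G) (ep q) (eq p) a))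
        where
        Spq : S p ≡ S q
        Spq = trans (T⇒≡true p∈) (sym (T⇒≡true q∈))

        Rpq : Rel p q
        Rpq = pq , Spq

        m : T (mask p q)
        m = Rel⇒mask p∈ Rpq

        m′ : T (mask q p)
        m′ = Rel⇒mask q∈ (Adj-sym H pq , sym Spq)
      ... | inj₁ (_ , wp , _)  | inj₂ (q∉ , wq , _) =
        contradiction (subst₂ (Adj G) (sym wp) (sym wq) (τ-adj q∉ _)) miss
      ... | inj₂ (p∉ , wp , _) | inj₁ (_ , wq , _)  =
        contradiction (subst₂ (Adj G) (sym wp) (sym wq) (Adj-sym G (τ-adj p∉ _))) miss
      ... | inj₂ (p∉ , wp , ep) | inj₂ (q∉ , wq , eq) =
        (pq , trans (¬T⇒≡false (T-not⁻ p∉)) (sym (¬T⇒≡false (T-not⁻ q∉)))) ,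
        subst₂ (Adj G) (sym wp) (sym (ep q)) (Adj-sym G (τ-adj p∉ _)) ,
        λ a → Far.nonadjacent (far (suc p) q (suc q) p (Adj-irrefl H pq ∘ suc-injective ∘ proj₁))
                (adjˢ⁺ (z-small _) (z-small _) (subst₂ (Adj G) (ep q) (eq p) a))

    homogeneous⇒potentially : PotentiallyGraphic H (degrees G)
    homogeneous⇒potentially = ready⇒potentially H w w-inj e Rel e-inj e∉w G ready

-- Subsets of vertices and the parameters of `H`.

∣∣-# : ∀ {n} (S : Subset n) → ∣ S ∣ ≡ # (lookup S)
∣∣-# S = trans (cong ∣_∣ (sym (tabulate∘lookup S))) (∣tabulate∣ (lookup S))

∈⇒T : ∀ {n} {S : Subset n} {i} → i ∈ S → T (lookup S i)
∈⇒T i∈S = Equivalence.from T-≡ ([]=⇒lookup i∈S)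

T⇒∈ : ∀ {n} {S : Subset n} {i} → T (lookup S i) → i ∈ S
T⇒∈ {S = S} {i} p = lookup⇒[]= i S (T⇒≡true p)

#-positive : ∀ {n} (f : Fin n → Bool) {i} → T (f i) → 1 ≤ # f
#-positive f {i} p = ≤-trans (s≤s z≤n) (#-remove f i p)

elements-∈ : ∀ {n} (S : Subset n) i → T (lookup S (elements S i))
elements-∈ (inside  ∷ S) zero    = tt
elements-∈ (inside  ∷ S) (suc i) = elements-∈ S i
elements-∈ (outside ∷ S) i       = elements-∈ S i

elements-injective : ∀ {n} (S : Subset n) → Injective _≡_ _≡_ (elements S)
elements-injective (inside  ∷ S) {zero}  {zero}  eq = refl
elements-injective (inside  ∷ S) {suc i} {suc j} eq =
    cong suc (elements-injective S (suc-injective eq))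
elements-injective (outside ∷ S) eq = elements-injective S (suc-injective eq)

elements-surjective : ∀ {n} (S : Subset n) i → T (lookup S i) → ∃ λ j → elements S j ≡ i
elements-surjective (inside  ∷ S) zero    p = zero , refl
elements-surjective (inside  ∷ S) (suc i) p with j , eq ← elements-surjective S i p = suc j ,
    cong suc eq
elements-surjective (outside ∷ S) (suc i) p with j , eq ← elements-surjective S i p = j ,
    cong suc eq

#-elements : ∀ {n} (S : Subset n) (f : Fin n → Bool) →
    # (f ∘ elements S) ≡ # (λ i → lookup S i ∧ f i)
#-elements []            f = refl
#-elements (inside  ∷ S) f = cong (𝟙 (f zero) +_) (#-elements S (f ∘ suc))
#-elements (outside ∷ S) f = #-elements S (f ∘ suc)

subsets-complete : ∀ {n} (S : Subset n) → S ∈ˡ subsets n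
subsets-complete []                = here refl
subsets-complete (inside ∷ S)      = ∈-++⁺ˡ (∈-map⁺ (inside ∷_) (subsets-complete S))
subsets-complete {suc n} (outside ∷ S) =
  ∈-++⁺ʳ (List.map (inside ∷_) (subsets n)) (∈-map⁺ (outside ∷_) (subsets-complete S))

shrink : ∀ {n} (S : Subset n) {i} → i ≤ ∣ S ∣ →
         ∃ λ S′ → ∣ S′ ∣ ≡ i × (∀ j → T (lookup S′ j) → T (lookup S j))
shrink []            z≤n = [] , refl , λ ()
shrink (outside ∷ S) i≤ with S′ , eq , sub ← shrink S i≤ =
  outside ∷ S′ , eq , λ { zero () ; (suc j) p → sub j p }
shrink (inside ∷ S) {zero}  i≤ with S′ , eq , sub ← shrink S {zero} z≤n =
  outside ∷ S′ , eq , λ { zero () ; (suc j) p → sub j p }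
shrink (inside ∷ S) {suc i} i≤ with S′ , eq , sub ← shrink S (s≤s⁻¹ i≤) =
  inside ∷ S′ , cong suc eq , λ { zero p → tt ; (suc j) p → sub j p }

degree≤Δ : ∀ {n} (G : Graph n) i → degree G i ≤ Δ G
degree≤Δ G i = All.lookup (xs≤max 0 (List.tabulate (degree G))) (∈-tabulate⁺ i)

Δ-attained : ∀ {n} (G : Graph n) → 1 ≤ Δ G → ∃ λ i → degree G i ≡ Δ G
Δ-attained G 1≤Δ with argmax-sel id 0 (List.tabulate (degree G))
... | inj₁ eq = contradiction 1≤Δ (subst (λ m → ¬ 1 ≤ m) (sym eq) λ ())
... | inj₂ m with i , eq ← ∈-tabulate⁻ {f = degree G} m = i , sym eq

degree-induced : ∀ {n} (G : Graph n) (S : Subset n) j →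
                 degree (induced G S) j ≡ # (λ i → lookup S i ∧ adj G (elements S j) i)
degree-induced G S j = trans (degree-# (induced G S) j) (#-elements S (adj G (elements S j)))

degree-in≤Δ-induced : ∀ {n} (G : Graph n) (S : Subset n) i → T (lookup S i) →
                      # (λ j → lookup S j ∧ adj G i j) ≤ Δ (induced G S)
degree-in≤Δ-induced G S i p with j , refl ← elements-surjective S i p =
  subst (_≤ Δ (induced G S)) (degree-induced G S j) (degree≤Δ (induced G S) j)

independent≤α : ∀ {n} (G : Graph n) S → Independent G S → ∣ S ∣ ≤ α G
independent≤α {n} G S ind =
    All.lookup (xs≤max 0 (List.map ∣_∣ (filter (independent? G) (subsets n))))
  (∈-map⁺ ∣_∣ (∈-filter⁺ (independent? G) (subsets-complete S) ind))

α-attained : ∀ {n} (G : Graph n) → ∃ λ S → Independent G S × ∣ S ∣ ≡ α G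
α-attained {n} G with argmax-sel id 0 (List.map ∣_∣ (filter (independent? G) (subsets n)))
... | inj₁ eq = ⊥ˢ , (λ i j i∈ → contradiction i∈ ∉⊥) , trans (∣⊥∣≡0 n) (sym eq)
... | inj₂ m with S , S∈ , eq ← ∈-map⁻ ∣_∣ m =
  S , proj₂ (∈-filter⁻ (independent? G) {xs = subsets n} S∈) , sym eq

module _ {k : ℕ} (H : Graph k) where

  ∇≤Δ-induced : ∀ {i} S → ∣ S ∣ ≡ i → ∇ i H ≤ Δ (induced H S)
  ∇≤Δ-induced {i} S eq = All.lookup
      (min≤xs k (List.map (λ S → Δ (induced H S)) (filter (λ S → ∣ S ∣ ℕ.≟ i) (subsets k))))
    (∈-map⁺ (λ S → Δ (induced H S)) (∈-filter⁺ (λ S → ∣ S ∣ ℕ.≟ i) (subsets-complete S) eq))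

  ∇-attained : ∀ {i} → i ≤ k → ∃ λ S → ∣ S ∣ ≡ i ×
               (∀ p → T (lookup S p) → # (λ q → lookup S q ∧ adj H p q) ≤ ∇ i H)
  ∇-attained {i} i≤k with argmin-sel id k
      (List.map (λ S → Δ (induced H S)) (filter (λ S → ∣ S ∣ ℕ.≟ i) (subsets k)))
  -- Should the minimum be the default `k`, any set of size `i` serves, as no count exceeds `k`.
  ... | inj₁ eq with S , ∣S∣ , _ ← shrink (⊤ˢ {k}) {i} (subst (i ≤_) (sym (∣⊤∣≡n k)) i≤k) =
    S , ∣S∣ , λ p _ → subst (# (λ q → lookup S q ∧ adj H p q) ≤_) (sym eq)
        (#≤n (λ q → lookup S q ∧ adj H p q))
  ... | inj₂ m with S , S∈ , eq ← ∈-map⁻ (λ S → Δ (induced H S)) m =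
    S , proj₂ (∈-filter⁻ (λ S → ∣ S ∣ ℕ.≟ i) {xs = subsets k} S∈) ,
    λ p p∈ → subst (# (λ q → lookup S q ∧ adj H p q) ≤_) (sym eq) (degree-in≤Δ-induced H S p p∈)

  -- A set in which all induced degrees vanish is independent, hence no larger than `α H`.
  1≤Δ-induced : ∀ S → α H < ∣ S ∣ → 1 ≤ Δ (induced H S)
  1≤Δ-induced S α< with 1 ≤? Δ (induced H S)
  ... | yes 1≤Δ = 1≤Δ
  ... | no 1≰Δ = contradiction (independent≤α H S ind) (<⇒≱ α<)
    where
    ind : Independent H S
    ind i j i∈ j∈ ij = 1≰Δ (≤-trans
      (#-positive (λ q → lookup S q ∧ adj H i q) {j} (∧⁺ (∈⇒T j∈) ij))
      (degree-in≤Δ-induced H S i (∈⇒T i∈)))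

  1≤∇ : ∀ {i} → α H < i → i ≤ k → 1 ≤ ∇ i H
  1≤∇ {i} α<i i≤k = v≤min⁺ (≤-trans (s≤s z≤n) (≤-trans α<i i≤k)) (All.tabulate go)
    where
    go : ∀ {d} → d ∈ˡ List.map (λ S → Δ (induced H S)) (filter (λ S → ∣ S ∣ ℕ.≟ i) (subsets k)) →
        1 ≤ d
    go m with S , S∈ , refl ← ∈-map⁻ (λ S → Δ (induced H S)) m =
      1≤Δ-induced S (subst (α H <_)
          (sym (proj₂ (∈-filter⁻ (λ S → ∣ S ∣ ℕ.≟ i) {xs = subsets k} S∈))) α<i)

  σ~ᵢ≤σ~ : ∀ {i} → α H < i → i ≤ k → σ~ᵢ i H ≤ σ~ H
  σ~ᵢ≤σ~ {i} α<i i≤k = All.lookup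
      (xs≤max 0 (List.map (λ i → σ~ᵢ i H) (filter (λ i → α H <? i) (upTo (suc k)))))
    (∈-map⁺ (λ i → σ~ᵢ i H) (∈-filter⁺ (λ i → α H <? i) (∈-upTo⁺ (s≤s i≤k)) α<i))

  σ~-attained : 1 ≤ σ~ H → ∃ λ i → α H < i × i ≤ k × σ~ H ≡ σ~ᵢ i H
  σ~-attained 1≤σ~ with argmax-sel id 0
      (List.map (λ i → σ~ᵢ i H) (filter (λ i → α H <? i) (upTo (suc k))))
  ... | inj₁ eq = contradiction 1≤σ~ (subst (λ m → ¬ 1 ≤ m) (sym eq) λ ())
  ... | inj₂ m with i , i∈ , eq ← ∈-map⁻ (λ i → σ~ᵢ i H) m
               with i∈′ , α<i ← ∈-filter⁻ (λ i → α H <? i) {xs = upTo (suc k)} i∈ =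
    i , α<i , s≤s⁻¹ (∈-upTo⁻ i∈′) , eq

  #-complement : ∀ S → # (not ∘ lookup S) + ∣ S ∣ ≡ k
  #-complement S = trans (cong (# (not ∘ lookup S) +_) (∣∣-# S)) (#-not (lookup S))

  -- Here `s` and `t` stand for numbers of small and of large neighbours, so the hypothesis says
  -- that the degree `s + t` plus `t` exceeds `σ~ H`.
  select : ∀ s t → σ~ H < s + t + t → ∃ λ (S : Fin k → Bool) →
           # (not ∘ S) ≤ t × (∀ p → T (S p) → # (λ q → S q ∧ adj H p q) ≤ s)
  select s t σ~< with k ≤? t + α H
  ... | yes k≤ with S , ind , ∣S∣ ← α-attained H =
    lookup S ,
    +-cancelʳ-≤ (α H) _ _ (subst (_≤ t + α H)
        (trans (sym (#-complement S)) (cong (# (not ∘ lookup S) +_) ∣S∣)) k≤) ,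
    λ p p∈ → subst (_≤ s) (sym
        (#-false λ q m → ind p q (T⇒∈ p∈) (T⇒∈ (proj₁ (∧⁻ {lookup S q} m)))
        (proj₂ (∧⁻ {lookup S q} m)))) z≤n
  ... | no k≰ with S , ∣S∣ , deg ← ∇-attained {k ∸ t} (m∸n≤m k t) =
    lookup S ,
    ≤-reflexive (+-cancelʳ-≡ (k ∸ t)
        _ _ (trans (trans (cong (# (not ∘ lookup S) +_) (sym ∣S∣)) (#-complement S))
        (sym (m+[n∸m]≡n t≤k)))) ,
    λ p p∈ → ≤-trans (deg p p∈) ∇≤s
    where
    t≤k : t ≤ k
    t≤k = ≤-trans (m≤m+n t (α H)) (<⇒≤ (≰⇒> k≰))

    α<i : α H < k ∸ t
    α<i = +-cancelˡ-< t _ _ (subst (t + α H <_) (sym (m+[n∸m]≡n t≤k)) (≰⇒> k≰))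

    -- The index `k ∸ t` gives `2 * t + ∇ (k ∸ t) H ∸ 1 ≤ σ~ H`; the strict inequality in the
    -- hypothesis makes up for the 1.
    ∇≤s : ∇ (k ∸ t) H ≤ s
    ∇≤s = +-cancelˡ-≤ (t + t) _ _ (begin
      t + t + ∇ (k ∸ t) H
        ≡⟨ cong (λ m → t + m + ∇ (k ∸ t) H) (sym (+-identityʳ t)) ⟩
      2 * t + ∇ (k ∸ t) H
        ≡⟨ cong (λ m → 2 * m + ∇ (k ∸ t) H) (sym (m∸[m∸n]≡n t≤k)) ⟩
      2 * (k ∸ (k ∸ t)) + ∇ (k ∸ t) H           ≤⟨ m≤n+m∸n _ 1 ⟩
      suc (σ~ᵢ (k ∸ t) H)                       ≤⟨ s≤s (σ~ᵢ≤σ~ α<i (m∸n≤m k t)) ⟩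
      suc (σ~ H)                                ≤⟨ σ~< ⟩
      s + t + t                                 ≡⟨ trans (+-assoc s t t) (+-comm s (t + t)) ⟩
      t + t + s                                 ∎)
      where open ≤-Reasoning

-- The upper bound.

-- Each element of L halves P at worst.
homogenise : ∀ {n} (r : Fin n → Fin n → Bool) (L : List (Fin n)) (P : Fin n → Bool) {m} →
  2 ^ length L * m ≤ # P →
  ∃ λ (P′ : Fin n → Bool) → (∀ v → T (P′ v) → T (P v)) × m ≤ # P′ ×
    (∀ {l u v} → l ∈ˡ L → T (P′ u) → T (P′ v) → T (r u l) → T (r v l))
homogenise r []      P room = P , (λ _ → id) , subst (_≤ # P) (+-identityʳ _) room , λ ()
homogenise {n} r (l ∷ L) P {m} room = [ yes-case , no-case ]′ (≤-total half (# P₁))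
  where
  half = 2 ^ length L * m

  P₁ P₀ : Fin n → Bool
  P₁ v = r v l ∧ P v
  P₀ v = not (r v l) ∧ P v

  room′ : half + half ≤ # P₁ + # P₀
  room′ = subst₂ _≤_
    (trans (*-assoc 2 (2 ^ length L) m) (cong (half +_) (+-identityʳ half)))
    (#-split (λ v → r v l) P) room

  Result : Set
  Result = ∃ λ (P′ : Fin n → Bool) → (∀ v → T (P′ v) → T (P v)) × m ≤ # P′ ×
    (∀ {l′ u v} → l′ ∈ˡ (l ∷ L) → T (P′ u) → T (P′ v) → T (r u l′) → T (r v l′))

  yes-case : half ≤ # P₁ → Result
  yes-case h with P′ , sub , m≤ , hom ← homogenise r L P₁ h =
    P′ , (λ v → proj₂ ∘ ∧⁻ {r v l} ∘ sub v) , m≤ ,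
    λ { (here refl) u∈ v∈ _ → proj₁ (∧⁻ {r _ l} (sub _ v∈)) ; (there i) → hom i }

  no-case : # P₁ ≤ half → Result
  no-case h with P′ , sub , m≤ , hom ←
      homogenise r L P₀ (+-cancelˡ-≤ half _ _ (≤-trans room′ (+-monoˡ-≤ (# P₀) h))) =
    P′ , (λ v → proj₂ ∘ ∧⁻ {not (r v l)} ∘ sub v) , m≤ ,
    λ { (here refl) u∈ v∈ ul →
        contradiction ul (T-not⁻ (proj₁ (∧⁻ {not (r _ l)} (sub _ u∈)))) ; (there i) → hom i }

-- One representative and the far apart vertices that homogeneous⇒potentially takes.
supply : ℕ → ℕ
supply k = suc ((suc k * k) * suc (large k) ^ 3)

-- The excess over `σ~ H * n` that is possible with at most `2 ^ k * supply k` rich vertices and at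
-- most `k` large ones.
upperConstant : ℕ → ℕ
upperConstant k = 2 ^ k * supply k * (large k + k) + k * k

module _ {k n : ℕ} (H : Graph k) (G : Graph n) where

  private
    D : ℕ
    D = large k

    small : Fin n → Bool
    small v = does (degree G v <? D)

    open Partition G small

    t : Fin n → ℕ
    t v = # (adjᴸ v)

    rich : Fin n → Bool
    rich v = small v ∧ does (σ~ H <? degree G v + t v)

    ¬small⇒ : ∀ {v} → T (not (small v)) → D ≤ degree G v
    ¬small⇒ {v} p = ≮⇒≥ (T-not⁻ p ∘ does⁺ (degree G v <? D))

    many-large : k ≤ # (not ∘ small) → PotentiallyGraphic H (degrees G)
    many-large k≤ with w , w∈ , w-inj ← choose-distinct {k} (λ _ → true) (λ _ → not ∘ small) []
        (λ _ _ → subst (_≤ # (not ∘ small)) (trans (sym (#-const k)) (sym (+-identityʳ _))) k≤)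
        (λ _ ¬t → ⊥-elim (¬t tt)) =
      large-degrees⇒potentially H G w (w-inj _ _ tt tt) (λ p → ¬small⇒ (proj₁ (w∈ p tt)))

    bound : ∀ a → # (adjˢ a) ≤ D
    bound a with T? (small a)
    ... | yes a-small = ≤-trans (#-mono {f = adjˢ a} (λ b p → proj₂ (proj₂ (adjˢ⁻ {a} {b} p))))
                          (subst (_≤ D) (degree-# G a) (<⇒≤ (does⁻ (degree G a <? D) a-small)))
    ... | no ¬a-small = subst (_≤ D)
        (sym (#-false {f = adjˢ a} λ b p → ¬a-small (proj₁ (adjˢ⁻ {a} {b} p)))) z≤n

    degree≤ : ∀ {a} → T (small a) → degree G a ≤ # (adjˢ a) + t a
    degree≤ {a} p = subst (_≤ # (adjˢ a) + t a)
      (sym (trans (degree-# G a) (#-split small (adj G a))))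
      (+-monoˡ-≤ (t a) (#-mono {g = adjˢ a} λ b q → ∧⁺ p q))

    -- Both sides count the edges with a marked large end.
    large-edges : ∑ (λ v → 𝟙 (not (small v)) * degree G v) ≡ ∑ t
    large-edges = trans (sum-cong-≗ expand) (∑-comm (λ v j → 𝟙 (not (small v) ∧ adj G j v)))
      where
      expand : ∀ v → 𝟙 (not (small v)) * degree G v ≡ # (λ j → not (small v) ∧ adj G j v)
      expand v with not (small v)
      ... | false = sym (#-false {n} {λ j → false} (λ _ ()))
      ... | true  = trans (+-identityʳ _)
          (trans (degree-# G v) (sum-cong-≗ (λ j → cong 𝟙 (adj-sym G v j))))

    ∑-degree : ∑ (degree G) ≡ ∑ (λ v → 𝟙 (small v) * degree G v + t v)
    ∑-degree = begin
      ∑ (degree G)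
        ≡⟨ sum-cong-≗ (λ v → split (small v) (degree G v)) ⟩
      ∑ (λ v → 𝟙 (small v) * degree G v + 𝟙 (not (small v)) * degree G v)
        ≡⟨ ∑-distrib-+ (λ v → 𝟙 (small v) * degree G v) _ ⟩
      ∑ (λ v → 𝟙 (small v) * degree G v) + ∑ (λ v → 𝟙 (not (small v)) * degree G v)
        ≡⟨ cong (∑ (λ v → 𝟙 (small v) * degree G v) +_) large-edges ⟩
      ∑ (λ v → 𝟙 (small v) * degree G v) + ∑ t
        ≡⟨ sym (∑-distrib-+ (λ v → 𝟙 (small v) * degree G v) t) ⟩
      ∑ (λ v → 𝟙 (small v) * degree G v + t v) ∎
      where
      open ≡-Reasoning
      split : ∀ b d → d ≡ 𝟙 b * d + 𝟙 (not b) * d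
      split true  d = sym (trans (+-identityʳ _) (+-identityʳ d))
      split false d = sym (+-identityʳ d)

    module _ (few : # (not ∘ small) ≤ k) where

      t≤k : ∀ v → t v ≤ k
      t≤k v = ≤-trans (#-mono {f = adjᴸ v} (λ l → proj₁ ∘ ∧⁻ {not (small l)})) few

      -- A rich vertex contributes at most `D + k` and any other small vertex at most `σ~ H`. A
      -- large one contributes only `t v`, its degree having been distributed over its neighbours.
      term≤ : ∀ v → 𝟙 (small v) * degree G v + t v ≤ σ~ H + 𝟙 (rich v) * (D + k) + 𝟙 (not (small v))
          * k
      term≤ v = go (small v) (does (σ~ H <? degree G v + t v))
                  (<⇒≤ ∘ does⁻ (degree G v <? D))
                  (λ σ~≮ → ≮⇒≥ (σ~≮ ∘ does⁺ (σ~ H <? degree G v + t v)))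
        where
        go : ∀ a b → (T a → degree G v ≤ D) → (¬ T b → degree G v + t v ≤ σ~ H) →
             𝟙 a * degree G v + t v ≤ σ~ H + 𝟙 (a ∧ b) * (D + k) + 𝟙 (not a) * k
        go false _ _ _ = ≤-trans (t≤k v)
            (≤-trans (≤-reflexive (sym (+-identityʳ k))) (m≤n+m _ (σ~ H + 0)))
        go true true deg≤ _ = ≤-trans
            (+-mono-≤ (subst (_≤ D) (sym (+-identityʳ _)) (deg≤ tt)) (t≤k v))
          (≤-trans (≤-trans (≤-reflexive (sym (+-identityʳ (D + k)))) (m≤n+m _ (σ~ H))) (m≤m+n _ 0))
        go true false _ poor = ≤-trans (≤-reflexive (cong (_+ t v) (+-identityʳ _)))
          (≤-trans (poor id) (≤-trans (m≤m+n (σ~ H) 0) (m≤m+n _ 0)))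

      ∑-degree≤ : ∑ (degree G) ≤ σ~ H * n + (# rich * (D + k) + k * k)
      ∑-degree≤ = begin
        ∑ (degree G)
          ≡⟨ ∑-degree ⟩
        ∑ (λ v → 𝟙 (small v) * degree G v + t v)
          ≤⟨ ∑-mono term≤ ⟩
        ∑ (λ v → σ~ H + 𝟙 (rich v) * (D + k) + 𝟙 (not (small v)) * k)
          ≡⟨ ∑-distrib-+ (λ v → σ~ H + 𝟙 (rich v) * (D + k)) _ ⟩
        ∑ (λ v → σ~ H + 𝟙 (rich v) * (D + k)) + ∑ (λ v → 𝟙 (not (small v)) * k)
          ≡⟨ cong₂ _+_ (∑-distrib-+ (λ _ → σ~ H) (λ v → 𝟙 (rich v) * (D + k)))
              (∑-*ʳ (𝟙 ∘ not ∘ small) k) ⟩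
        ∑ {n} (λ _ → σ~ H) + ∑ (λ v → 𝟙 (rich v) * (D + k)) + # (not ∘ small) * k
          ≤⟨ +-mono-≤ (≤-reflexive (cong₂ _+_ (trans (∑-const n (σ~ H)) (*-comm n (σ~ H)))
              (∑-*ʳ (𝟙 ∘ rich) (D + k))))
                      (*-monoˡ-≤ k few) ⟩
        σ~ H * n + # rich * (D + k) + k * k
          ≡⟨ +-assoc (σ~ H * n) _ _ ⟩
        σ~ H * n + (# rich * (D + k) + k * k) ∎
        where open ≤-Reasoning

      many-rich : 2 ^ k * supply k ≤ # rich → PotentiallyGraphic H (degrees G)
      many-rich room
        with P , P⊆ , supply≤ , hom ← homogenise (adj G) (members (not ∘ small)) rich {supply k}
               (≤-trans (*-monoˡ-≤ (supply k)
                   (^-monoʳ-≤ 2 (subst (_≤ k) (sym (length-members (not ∘ small))) few))) room)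
        with v , v∈ ← #-nonempty P (≤-trans (s≤s z≤n) supply≤)
        with z , z∈ , z-far ← choose-far bound {suc k * k} P (<⇒≤ supply≤)
        -- The first argument is the least one that `select` admits for `t v`. By `enough`, each
        -- `z i` has at least that many small neighbours.
        with S , S-large , S-small ← select H (suc (σ~ H) ∸ (t v + t v)) (t v)
               (subst (suc (σ~ H) ≤_) (trans (+-comm (t v + t v) _) (sym (+-assoc _ (t v) (t v))))
                   (m≤n+m∸n (suc (σ~ H)) (t v + t v))) =
        homogeneous⇒potentially H S v z
          (λ i → proj₁ (∧⁻ {small (z i)} (P⊆ _ (z∈ i))))
          z-far
          (λ i l p → hom (∈-members (not ∘ small) (proj₁ (∧⁻ {not (small l)} p))) v∈ (z∈ i)
              (proj₂ (∧⁻ {not (small l)} p)))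
          S-large
          (λ i p p∈ → ≤-trans (S-small p p∈) (m≤n+o⇒m∸n≤o (suc (σ~ H)) (t v + t v) (enough i)))
        where
        enough′ : ∀ {u} → T (rich u) → t u ≤ t v → suc (σ~ H) ≤ t v + t v + # (adjˢ u)
        enough′ {u} p tu≤ with p₁ , p₂ ← ∧⁻ {small u} p = begin
          suc (σ~ H)                   ≤⟨ does⁻ (σ~ H <? degree G u + t u) p₂ ⟩
          degree G u + t u             ≤⟨ +-mono-≤ (degree≤ p₁) tu≤ ⟩
          # (adjˢ u) + t u + t v       ≤⟨ +-monoˡ-≤ (t v) (+-monoʳ-≤ (# (adjˢ u)) tu≤) ⟩
          # (adjˢ u) + t v + t v
            ≡⟨ trans (+-assoc (# (adjˢ u)) (t v) (t v)) (+-comm (# (adjˢ u)) _) ⟩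
          t v + t v + # (adjˢ u)       ∎
          where open ≤-Reasoning

        enough : ∀ i → suc (σ~ H) ≤ t v + t v + # (adjˢ (z i))
        enough i = enough′ (P⊆ _ (z∈ i)) (#-mono {f = adjᴸ (z i)} λ l p →
          ∧⁺ (proj₁ (∧⁻ {not (small l)} p))
             (hom (∈-members (not ∘ small) (proj₁ (∧⁻ {not (small l)} p))) (z∈ i) v∈
                 (proj₂ (∧⁻ {not (small l)} p))))

  dense⇒potentially : σ~ H * n + upperConstant k < ∑ (degree G) → PotentiallyGraphic H (degrees G)
  dense⇒potentially dense with k ≤? # (not ∘ small)
  ... | yes k≤ = many-large k≤
  ... | no k≰ with 2 ^ k * supply k ≤? # rich
  ...   | yes room = many-rich (<⇒≤ (≰⇒> k≰)) room
  ...   | no ¬room = contradiction dense (≤⇒≯ (≤-trans (∑-degree≤ (<⇒≤ (≰⇒> k≰)))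
    (+-monoʳ-≤ (σ~ H * n) (+-monoˡ-≤ (k * k) (*-monoˡ-≤ (D + k) (<⇒≤ (≰⇒> ¬room)))))))

dense⇒forces : ∀ {k} (H : Graph k) n {s} → σ~ H * n + upperConstant k < s → Forces H n s
dense⇒forces H n <s _ (G , refl) s≤ =
  dense⇒potentially H G (≤-trans <s (subst (_ ≤_) (sum-tabulate (degree G)) s≤))

-- The extremal graph and the lower bound.

below : ∀ {n} → ℕ → Fin n → Bool
below r a = does (toℕ a <? r)

#-below : ∀ n {r} → r ≤ n → # {n} (below r) ≡ r
#-below n       {zero}  r≤n = #-false {n} {below 0} λ i p →
    contradiction (does⁻ (toℕ i <? 0) p) λ ()
#-below (suc n) {suc r} r≤n = cong suc (#-below n (s≤s⁻¹ r≤n))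

-- r dominating vertices; the other vertices fall into cliques of suc d consecutive ones.
-- Only the first and the last clique may be incomplete, whence a bounded defect.
module Extremal (n r d : ℕ) where

  private
    e : ℕ
    e = suc d

  same : Fin n → Fin n → Bool
  same a b = does (toℕ a / e ℕ.≟ toℕ b / e)

  -- Adjacent or equal, so that a block is counted with its full size.
  linked : Fin n → Fin n → Bool
  linked a b = (below r a ∨ below r b) ∨ same a b

  linked-sym : ∀ a b → linked a b ≡ linked b a
  linked-sym a b = cong₂ _∨_ (∨-comm (below r a) _)
      (does-⇔ (mk⇔ sym sym) (toℕ a / e ℕ.≟ toℕ b / e) (toℕ b / e ℕ.≟ toℕ a / e))

  linked-refl : ∀ a → T (linked a a)
  linked-refl a = ∨⁺ {below r a ∨ below r a} (inj₂ (does⁺ (toℕ a / e ℕ.≟ toℕ a / e) refl))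

  extremal : Graph n
  extremal = record
    { adj        = λ a → linked a ∖ a
    ; adj-sym    = λ a b → cong₂ (λ x y → not x ∧ y) (does-⇔ (mk⇔ sym sym) (b ≟ a) (a ≟ b))
        (linked-sym a b)
    ; adj-irrefl = λ a → ¬T⇒≡false {(linked a ∖ a) a} λ p → proj₂ (∖⁻ (linked a) {a} {a} p) refl
    }

  #-linked≤ : ∀ a → # (linked a) ≤ suc (degree extremal a)
  #-linked≤ a = subst (λ m → # (linked a) ≤ suc m) (sym (degree-# extremal a))
      (#-remove-≤ (linked a) a)

  #-linked≥ : ∀ a → suc (degree extremal a) ≤ # (linked a)
  #-linked≥ a = subst (λ m → suc m ≤ # (linked a)) (sym (degree-# extremal a))
      (#-remove (linked a) a (linked-refl a))

  degree-below : ∀ a → T (below r a) → n ≤ suc (degree extremal a)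
  degree-below a p = ≤-trans
    (subst (_≤ # (linked a)) (#-const n)
      (#-mono {f = λ _ → true} {g = linked a} λ b _ →
          ∨⁺ {below r a ∨ below r b} (inj₁ (∨⁺ (inj₁ p)))))
    (#-linked≤ a)

  -- Members of one block have the same quotient by `e`, so their remainders tell them apart.
  #-same : ∀ a → # (same a) ≤ e
  #-same a = subst (# (same a) ≤_) (#-const e)
    (#-inject (same a) (λ _ → true) (λ b → fromℕ< (m%n<n (toℕ b) e)) (λ _ _ → tt) inj)
    where
    inj : ∀ b c → T (same a b) → T (same a c) →
        fromℕ< (m%n<n (toℕ b) e) ≡ fromℕ< (m%n<n (toℕ c) e) → b ≡ c
    inj b c p q eq = toℕ-injective (begin
      toℕ b                           ≡⟨ m≡m%n+[m/n]*n (toℕ b) e ⟩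
      toℕ b % e + toℕ b / e * e       ≡⟨ cong₂ (λ x y → x + y * e)
                                          (trans (sym (toℕ-fromℕ< _))
                                        (trans (cong toℕ eq) (toℕ-fromℕ< _)))
                                          (trans (sym (does⁻ (toℕ a / e ℕ.≟ toℕ b / e) p))
                                        (does⁻ (toℕ a / e ℕ.≟ toℕ c / e) q)) ⟩
      toℕ c % e + toℕ c / e * e       ≡⟨ sym (m≡m%n+[m/n]*n (toℕ c) e) ⟩
      toℕ c                           ∎)
      where open ≡-Reasoning

  module _ (r+e≤n : r + e ≤ n) where

    #-below-r : # {n} (below r) ≡ r
    #-below-r = #-below n (≤-trans (m≤m+n r e) r+e≤n)

    degree-above : ∀ a → ¬ T (below r a) → degree extremal a ≤ r + d
    degree-above a p = s≤s⁻¹ (begin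
      suc (degree extremal a)                                           ≤⟨ #-linked≥ a ⟩
      # (linked a)
        ≡⟨ #-split (below r) (linked a) ⟩
      # (λ b → below r b ∧ linked a b) + # (λ b → not (below r b) ∧ linked a b)
        ≤⟨ +-mono-≤ (#-mono {n} {λ b → below r b ∧ linked a b} {below r}
            (λ b → proj₁ ∘ ∧⁻ {below r b})) (#-mono {g = same a} rest) ⟩
      # {n} (below r) + # (same a)
        ≤⟨ +-mono-≤ (≤-reflexive #-below-r) (#-same a) ⟩
      r + suc d                                                         ≡⟨ +-suc r d ⟩
      suc (r + d)                                                       ∎)
      where
      open ≤-Reasoning
      rest : ∀ b → T (not (below r b) ∧ linked a b) → T (same a b)
      rest b q with q₁ , q₂ ← ∧⁻ {not (below r b)} q with ∨⁻ {below r a ∨ below r b} q₂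
      ... | inj₂ s = s
      ... | inj₁ s with ∨⁻ {below r a} s
      ...   | inj₁ s′ = contradiction s′ p
      ...   | inj₂ s′ = contradiction s′ (T-not⁻ q₁)

    -- The two bounds on `a` ensure that its block is complete and contains none of the dominating
    -- vertices.
    degree-block : ∀ a → r + e ≤ toℕ a → toℕ a + e ≤ n → r + d ≤ degree extremal a
    degree-block a lo hi = s≤s⁻¹ (begin
      suc (r + d)                                                       ≡⟨ sym (+-suc r d) ⟩
      r + e
        ≡⟨ cong₂ _+_ (sym #-below-r) (sym (#-const e)) ⟩
      # {n} (below r) + # {e} (λ _ → true)
        ≤⟨ +-mono-≤ (#-mono {n} {below r} {λ b → below r b ∧ linked a b} λ b p →
            ∧⁺ p (∨⁺ {below r a ∨ below r b} (inj₁ (∨⁺ {below r a} (inj₂ p)))))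
                    (#-inject (λ _ → true) (λ b → not (below r b) ∧ linked a b) φ φ-ok φ-inj) ⟩
      # (λ b → below r b ∧ linked a b) + # (λ b → not (below r b) ∧ linked a b)
        ≡⟨ sym (#-split (below r) (linked a)) ⟩
      # (linked a)                                                      ≤⟨ #-linked≤ a ⟩
      suc (degree extremal a)                                           ∎)
      where
      open ≤-Reasoning
      origin : ℕ
      origin = toℕ a / e * e

      origin+e≤n : origin + e ≤ n
      origin+e≤n = ≤-trans (+-monoˡ-≤ e
          (subst (origin ≤_) (sym (m≡m%n+[m/n]*n (toℕ a) e)) (m≤n+m origin _))) hi

      r≤origin : r ≤ origin
      r≤origin = +-cancelʳ-≤ e r origin (begin
        r + e                       ≤⟨ lo ⟩
        toℕ a                       ≡⟨ m≡m%n+[m/n]*n (toℕ a) e ⟩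
        toℕ a % e + origin           ≤⟨ +-monoˡ-≤ origin (<⇒≤ (m%n<n (toℕ a) e)) ⟩
        e + origin                   ≡⟨ +-comm e origin ⟩
        origin + e                   ∎)

      φ< : ∀ (j : Fin e) → origin + toℕ j < n
      φ< j = ≤-trans (+-monoʳ-< origin (toℕ<n j)) origin+e≤n

      φ : Fin e → Fin n
      φ j = fromℕ< (φ< j)

      φ-ok : ∀ j → T true → T (not (below r (φ j)) ∧ linked a (φ j))
      φ-ok j _ = ∧⁺
        (T-not⁺ λ p → <⇒≱ (subst (_< r) (toℕ-fromℕ< (φ< j)) (does⁻ (toℕ (φ j) <? r) p))
            (≤-trans r≤origin (m≤m+n origin (toℕ j))))
        (∨⁺ {below r a ∨ below r (φ j)} (inj₂ (does⁺ (toℕ a / e ℕ.≟ toℕ (φ j) / e)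
          (sym (trans (cong (_/ e) (toℕ-fromℕ< (φ< j)))
            (trans (+-distrib-/-∣ˡ {origin} (toℕ j) (n∣m*n (toℕ a / e)))
              (trans (cong₂ _+_ (m*n/n≡m (toℕ a / e) e) (m<n⇒m/n≡0 (toℕ<n j)))
                  (+-identityʳ _))))))))

      φ-inj : ∀ i j → T true → T true → φ i ≡ φ j → i ≡ j
      φ-inj i j _ _ eq = toℕ-injective (+-cancelˡ-≡ origin _ _
        (trans (sym (toℕ-fromℕ< (φ< i))) (trans (cong toℕ eq) (toℕ-fromℕ< (φ< j)))))

    -- An allowance for the first `r + e` and the last `e` vertices. The `suc` is there because a
    -- dominating vertex has degree one less than `n`.
    defect : ℕ
    defect = (r + e) * suc (r + d) + e * (r + d)

    ∑-degree≥ : (2 * r + d) * n ≤ ∑ (degree extremal) + defect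
    ∑-degree≥ = begin
      (2 * r + d) * n
        ≡⟨ cong (_* n) (trans (cong (λ x → r + x + d) (+-identityʳ r)) (+-assoc r r d)) ⟩
      (r + (r + d)) * n
        ≡⟨ trans (*-distribʳ-+ n r (r + d)) (+-comm (r * n) _) ⟩
      (r + d) * n + r * n
        ≡⟨ cong₂ _+_ (trans (*-comm (r + d) n) (sym (∑-const n (r + d))))
                     (trans (cong (_* n) (sym #-below-r)) (sym (∑-*ʳ {n} (𝟙 ∘ below r) n))) ⟩
      ∑ {n} (λ _ → r + d) + ∑ {n} (λ a → 𝟙 (below r a) * n)
        ≡⟨ sym (∑-distrib-+ {n} (λ _ → r + d) _) ⟩
      ∑ {n} (λ a → r + d + 𝟙 (below r a) * n)
        ≤⟨ ∑-mono term ⟩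
      ∑ {n} (λ a → degree extremal a +
          (𝟙 (below (r + e) a) * suc (r + d) + 𝟙 (not (below (n ∸ e) a)) * (r + d)))
        ≡⟨ trans (∑-distrib-+ (degree extremal) _) (cong (∑ (degree extremal) +_)
             (trans (∑-distrib-+ {n} (λ a → 𝟙 (below (r + e) a) * suc (r + d)) _)
               (cong₂ _+_ (∑-*ʳ {n} (𝟙 ∘ below (r + e)) (suc (r + d)))
                   (∑-*ʳ {n} (𝟙 ∘ not ∘ below (n ∸ e)) (r + d))))) ⟩
      ∑ (degree extremal) + (# {n} (below (r + e)) * suc (r + d) + # {n} (not ∘ below (n ∸ e)) *
          (r + d))
        ≡⟨ cong₂ (λ x y → ∑ (degree extremal) + (x * suc (r + d) + y * (r + d))) (#-below n r+e≤n)
            last ⟩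
      ∑ (degree extremal) + defect ∎
      where
      open ≤-Reasoning
      e≤n : e ≤ n
      e≤n = ≤-trans (m≤n+m e r) r+e≤n

      last : # {n} (not ∘ below (n ∸ e)) ≡ e
      last = +-cancelʳ-≡ (n ∸ e)
          _ _ (trans (cong (# {n} (not ∘ below (n ∸ e)) +_) (sym (#-below n (m∸n≤m n e))))
        (trans (#-not {n} (below (n ∸ e))) (sym (m+[n∸m]≡n e≤n))))

      term : ∀ a → r + d + 𝟙 (below r a) * n ≤
             degree extremal a + (𝟙 (below (r + e) a) * suc (r + d) + 𝟙 (not (below (n ∸ e) a)) *
                 (r + d))
      term a = go (below r a) (below (r + e) a) (below (n ∸ e) a)
        (degree-below a)
        (λ p → does⁺ (toℕ a <? r + e) (≤-trans (does⁻ (toℕ a <? r) p) (m≤m+n r e)))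
        (λ p q → degree-block a (≮⇒≥ (p ∘ does⁺ (toℕ a <? r + e)))
          (≤-trans (+-monoˡ-≤ e (<⇒≤ (does⁻ (toℕ a <? n ∸ e) q))) (≤-reflexive (m∸n+n≡m e≤n))))
        where
        go : ∀ x y z → (T x → n ≤ suc (degree extremal a)) → (T x → T y) →
            (¬ T y → T z → r + d ≤ degree extremal a) →
             r + d + 𝟙 x * n ≤ degree extremal a + (𝟙 y * suc (r + d) + 𝟙 (not z) * (r + d))
        go true false z _ xy _ = contradiction (xy tt) id
        go true true  z n≤ _ _ = begin
          r + d + (n + 0)
            ≡⟨ cong (r + d +_) (+-identityʳ n) ⟩
          r + d + n
            ≤⟨ +-monoʳ-≤ (r + d) (n≤ tt) ⟩
          r + d + suc (degree extremal a)
            ≡⟨ trans (+-suc (r + d) _) (+-comm (suc (r + d)) (degree extremal a)) ⟩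
          degree extremal a + suc (r + d)
            ≤⟨ +-monoʳ-≤ (degree extremal a) (≤-trans (m≤m+n (suc (r + d)) 0) (m≤m+n _ _)) ⟩
          degree extremal a + (1 * suc (r + d) + 𝟙 (not z) * (r + d))             ∎
        go false true  z _ _ _ = begin
          r + d + 0
            ≡⟨ +-identityʳ (r + d) ⟩
          r + d                                                                   ≤⟨ n≤1+n (r + d) ⟩
          suc (r + d)
            ≤⟨ ≤-trans (m≤m+n (suc (r + d)) 0) (m≤m+n _ _) ⟩
          1 * suc (r + d) + 𝟙 (not z) * (r + d)
            ≤⟨ m≤n+m _ (degree extremal a) ⟩
          degree extremal a + (1 * suc (r + d) + 𝟙 (not z) * (r + d))             ∎
        go false false true  _ _ block =
            subst₂ _≤_ (sym (+-identityʳ (r + d))) (sym (+-identityʳ _)) (block id tt)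
        go false false false _ _ _ = begin
          r + d + 0                              ≤⟨ m≤n+m _ (degree extremal a) ⟩
          degree extremal a + (r + d + 0)        ∎

    extremal-free : ∀ {k} (H : Graph k) {i} → i ≤ k → r ≡ k ∸ i → ∇ i H ≡ e →
                    ¬ PotentiallyGraphic H (degrees extremal)
    extremal-free {k} H {i} i≤k r≡ ∇≡e (G , realizes , f , f-inj , f-hom) =
      contra (shrink (tabulate outside?) i≤)
      where
      degree-G : ∀ a → degree G a ≡ degree extremal a
      degree-G a = trans (sym (lookup∘tabulate (degree G) a))
        (trans (cong (λ π → lookup π a) realizes) (lookup∘tabulate (degree extremal) a))

      -- The degree is at least `n` minus one, so besides `a` itself no second vertex `b` can be
      -- missed.
      dominating : ∀ {a b} → T (below r a) → a ≢ b → Adj G a b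
      dominating {a} {b} low a≢b with T? (adj G a b)
      ... | yes ab = ab
      ... | no ¬ab = contradiction
          (≤-trans (degree-below a low)
          (≤-reflexive (cong suc (trans (sym (degree-G a)) (degree-# G a)))))
        (<⇒≱ (begin
          suc (suc (# (adj G a)))     ≤⟨ s≤s (s≤s (#-mono {f = adj G a} λ c ac →
                                           ∖⁺ (all ∖ a) {b} {c} (∖⁺ all {a} {c} tt
                                        (Adj-irrefl G ac ∘ sym)) λ { refl → ¬ab ac })) ⟩
          suc (suc (# ((all ∖ a) ∖ b)))
            ≤⟨ s≤s (#-remove (all ∖ a) b (∖⁺ all {a} {b} tt (a≢b ∘ sym))) ⟩
          suc (# (all ∖ a))           ≤⟨ #-remove all a tt ⟩
          # all                       ≡⟨ #-const n ⟩
          n                           ∎))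
        where
        open ≤-Reasoning
        all : Fin n → Bool
        all _ = true

      outside? : Fin k → Bool
      outside? p = not (below r (f p))

      i≤ : i ≤ ∣ tabulate outside? ∣
      i≤ = +-cancelʳ-≤ r _ _ (begin
        i + r                                        ≡⟨ trans (cong (i +_) r≡) (m+[n∸m]≡n i≤k) ⟩
        k                                            ≡⟨ sym (#-not (below r ∘ f)) ⟩
        # outside? + # (below r ∘ f)
          ≤⟨ +-monoʳ-≤ (# outside?)
              (#-inject (below r ∘ f) (below r) f (λ _ → id) (λ _ _ _ _ → f-inj)) ⟩
        # outside? + # {n} (below r)
          ≡⟨ cong₂ _+_ (sym (∣tabulate∣ outside?)) #-below-r ⟩
        ∣ tabulate outside? ∣ + r                   ∎)
        where open ≤-Reasoning

      -- A vertex of maximum degree among `i` vertices of the copy that do not dominate has at least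
      -- `e` neighbours there, besides the `r` dominating ones. This exceeds the bound `r + d` on
      -- its degree.
      contra : (∃ λ S → ∣ S ∣ ≡ i × (∀ j → T (lookup S j) → T (lookup (tabulate outside?) j))) → ⊥
      contra (S , ∣S∣ , sub) with j , deg-j ← Δ-attained (induced H S)
          (≤-trans (subst (1 ≤_) (sym ∇≡e) (s≤s z≤n)) (∇≤Δ-induced H S ∣S∣)) =
        <⇒≱ (≤-reflexive (sym (+-suc r d))) (begin
          r + e
            ≤⟨ +-mono-≤ (≤-reflexive (sym #-below-r)) e≤ ⟩
          # {n} (below r) + degree (induced H S) j
            ≤⟨ +-mono-≤ (#-mono {n} {below r} {λ b → below r b ∧ adj G v b} λ b low →
                ∧⁺ low (Adj-sym G (dominating low λ eq →
                T-not⁻ (S-above j) (subst (T ∘ below r) eq low))))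
                        (subst (_≤ # (λ b → not (below r b) ∧ adj G v b))
                            (sym (degree-# (induced H S) j))
                          (#-inject (adj (induced H S) j) (λ b → not (below r b) ∧ adj G v b)
                              (f ∘ elements S)
                            (λ x jx → ∧⁺ (S-above x) (f-hom _ _ jx))
                            (λ _ _ _ _ → elements-injective S ∘ f-inj))) ⟩
          # (λ b → below r b ∧ adj G v b) + # (λ b → not (below r b) ∧ adj G v b)
            ≡⟨ sym (#-split (below r) (adj G v)) ⟩
          # (adj G v)
            ≡⟨ trans (sym (degree-# G v)) (degree-G v) ⟩
          degree extremal v
            ≤⟨ degree-above v (T-not⁻ (S-above j)) ⟩
          r + d                                                        ∎)
        where
        open ≤-Reasoning
        v : Fin n
        v = f (elements S j)

        S-above : ∀ x → T (outside? (elements S x))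
        S-above x = subst T (lookup∘tabulate outside? (elements S x)) (sub _ (elements-∈ S x))

        e≤ : e ≤ degree (induced H S) j
        e≤ = subst₂ _≤_ ∇≡e (sym deg-j) (∇≤Δ-induced H S ∣S∣)

-- From the two bounds to the asymptotics.

open import Data.Integer using (+_; _-_)

forces⇒σ≤ : ∀ {k} (H : Graph k) n x → (∀ {s} → x < s → Forces H n s) → σ H n ≤ x + 2
forces⇒σ≤ H n x forces = begin
  σ H n   ≤⟨ proj₂ (σ-isPotentialNumber H n) s (n∣m*n (suc (x / 2)) , forces x<s) ⟩
  s       ≤⟨ +-monoʳ-≤ 2 (m/n*n≤m x 2) ⟩
  2 + x   ≡⟨ +-comm 2 x ⟩
  x + 2   ∎
  where
  open ≤-Reasoning
  s : ℕ
  -- The least even number above `x`.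
  s = suc (x / 2) * 2

  x<s : x < s
  x<s = subst (_< s) (sym (m≡m%n+[m/n]*n x 2)) (+-monoˡ-< (x / 2 * 2) (m%n<n x 2))

σ≤ : ∀ {k} (H : Graph k) → ∃ λ C → ∀ n → σ H n ≤ σ~ H * n + C
σ≤ {k} H = bound (upperConstant k) (dense⇒forces H)
  where
  bound : ∀ U → (∀ n {s} → σ~ H * n + U < s → Forces H n s) → ∃ λ C → ∀ n → σ H n ≤ σ~ H * n + C
  bound U forces = U + 2 , λ n →
    subst (σ H n ≤_) (+-assoc (σ~ H * n) U 2) (forces⇒σ≤ H n (σ~ H * n + U) (forces n))

σ≥ : ∀ {k} (H : Graph k) → ∃₂ λ C N → ∀ n → n ≥ N → σ~ H * n ≤ σ H n + C
σ≥ {k} H = [ positive , vanishing ]′ (<-≤-connex 0 (σ~ H))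
  where
  Bound : Set
  Bound = ∃₂ λ C N → ∀ n → n ≥ N → σ~ H * n ≤ σ H n + C

  vanishing : σ~ H ≤ 0 → Bound
  vanishing σ~≤0 = 0 , 0 , λ n _ → ≤-trans (*-monoˡ-≤ n σ~≤0) z≤n

  -- Writing the positive number `∇ i H` as `suc d` turns `σ~ H` into `2 * r + d`, free of truncated
  -- subtraction.
  attained : ∀ i → i ≤ k → ∀ e → ∇ i H ≡ e → 1 ≤ e → σ~ H ≡ σ~ᵢ i H → Bound
  attained i i≤k (suc d) ∇≡ _ σ~≡ = (r + suc d) * suc (r + d) + suc d * (r + d) , r + suc d , bound
    where
    r : ℕ
    r = k ∸ i

    σ~≡2r+d : σ~ H ≡ 2 * r + d
    σ~≡2r+d = trans σ~≡ (cong (_∸ 1) (trans (cong (λ m → 2 * r + m) ∇≡) (+-suc (2 * r) d)))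

    bound : ∀ n → n ≥ r + suc d → σ~ H * n ≤ σ H n + ((r + suc d) * suc (r + d) + suc d * (r + d))
    bound n r+e≤n = ≤-trans
      (subst (λ m → m * n ≤ ∑ (degree extremal) + defect r+e≤n) (sym σ~≡2r+d) (∑-degree≥ r+e≤n))
      (+-monoˡ-≤ (defect r+e≤n) ∑≤σ)
      where
      open Extremal n r d

      -- Otherwise `H` would be forced in some realization of the extremal degrees.
      ∑≤σ : ∑ (degree extremal) ≤ σ H n
      ∑≤σ = [ <⇒≤ , (λ σ≤∑ → contradiction
        (proj₂ (proj₁ (σ-isPotentialNumber H n)) (degrees extremal) (extremal , refl)
          (subst (σ H n ≤_) (sym (sum-tabulate (degree extremal))) σ≤∑))
        (extremal-free r+e≤n H i≤k refl ∇≡)) ]′ (<-≤-connex (∑ (degree extremal)) (σ H n))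

  positive : 0 < σ~ H → Bound
  positive 1≤σ~ =
    let i , α<i , i≤k , σ~≡ = σ~-attained H 1≤σ~
    in attained i i≤k (∇ i H) refl (1≤∇ H α<i i≤k) σ~≡

∣+-+∣≤ : ∀ {a b c} → a ≤ b + c → b ≤ a + c → ℤ.∣ + a - + b ∣ ≤ c
∣+-+∣≤ {a} {b} {c} a≤ b≤ rewrite ℤ.m-n≡m⊖n a b with ≤-total b a
... | inj₁ b≤a rewrite ℤ.⊖-≥ b≤a = m≤n+o⇒m∸n≤o a b a≤
... | inj₂ a≤b rewrite ℤ.∣m⊖n∣≡∣n⊖m∣ a b | ℤ.⊖-≥ a≤b = m≤n+o⇒m∸n≤o b a b≤

-- A positive `ε` with denominator `suc q-1` is at least the reciprocal of that denominator, so `C`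
-- is at most `ε` times `n` once `n ≥ C * suc q-1`.
bounded⇒littleO : ∀ {f C N} → (∀ n → n ≥ N → ℤ.∣ f n ∣ ≤ C) → IsLittleO[n] f
bounded⇒littleO {f} {C} {N} bounded ε@(mkℚ (+ suc p) q-1 _) 0<ε = N ⊔ C * suc q-1 , λ n n≥ →
  ℚ.toℚᵘ-cancel-≤ (ℚᵘ.≤-respˡ-≃ (ℚᵘ.≃-sym (ℚ.toℚᵘ-fromℚᵘ (mkℚᵘ (+ ℤ.∣ f n ∣) 0)))
    (ℚᵘ.≤-respʳ-≃ (ℚᵘ.≃-sym (ℚᵘ.≃-trans (ℚ.toℚᵘ-homo-* ε (+ n ℚ./ 1))
        (ℚᵘ.*-cong (ℚᵘ.≃-refl {toℚᵘ ε}) (ℚ.toℚᵘ-fromℚᵘ (mkℚᵘ (+ n) 0)))))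
      (*≤* (subst₂ ℤ._≤_ (ℤ.pos-* ℤ.∣ f n ∣ (suc q-1 * 1))
          (trans (cong +_ (sym (*-identityʳ (suc p * n))))
          (trans (ℤ.pos-* (suc p * n) 1) (cong (ℤ._* (+ 1)) (ℤ.pos-* (suc p) n))))
        (ℤ.+≤+ (begin
          ℤ.∣ f n ∣ * (suc q-1 * 1)    ≡⟨ cong (ℤ.∣ f n ∣ *_) (*-identityʳ (suc q-1)) ⟩
          ℤ.∣ f n ∣ * suc q-1          ≤⟨ *-monoˡ-≤ (suc q-1) (bounded n (≤-trans (m≤m⊔n N _) n≥)) ⟩
          C * suc q-1                  ≤⟨ ≤-trans (m≤n⊔m N _) n≥ ⟩
          n                            ≤⟨ m≤m+n n (p * n) ⟩
          suc p * n                    ∎))))))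
  where open ≤-Reasoning
bounded⇒littleO _ (mkℚ (+ zero) _ _) (ℚ.*<* (ℤ.+<+ ()))
bounded⇒littleO _ (mkℚ (ℤ.-[1+_] _) _ _) (ℚ.*<* ())

theorem2 : ∀ {k : ℕ} (H : Graph k) → HasEdge H →
    IsLittleO[n] (λ n → + σ H n - + (σ~ H * n))
theorem2 H _ =
  let C , σ≤C = σ≤ H
      C′ , N , σ≥C′ = σ≥ H
  in bounded⇒littleO {λ n → + σ H n - + (σ~ H * n)} λ n n≥N → ∣+-+∣≤ {σ H n} {σ~ H * n}
       (≤-trans (σ≤C n) (+-monoʳ-≤ (σ~ H * n) (m≤m+n C C′)))
       (≤-trans (σ≥C′ n n≥N) (+-monoʳ-≤ (σ H n) (m≤n+m C′ C)))
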